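{- Let $G$ be a finite simple loopless graph with vertices $v_1,\ldots,v_n$ and edge weights $\operatorname{wg}(e)\in\mathbb{Z}[w,r]$, let $M$ be its weighted adjacency matrix, and let $X=\operatorname{diag}(x_1,\ldots,x_n)$ with $x_1,\ldots,x_n$ commuting indeterminates over $\mathbb{Z}[w,r]$. Let $k\ge 3$ and let $\mathcal{C}_k(G)$ denote the set of unoriented simple cycles of length $k$ in $G$. Then $$\operatorname{SF}\!\left(\operatorname{tr}\bigl((XM)^k\bigr)\right)=2k\sum_{C\in\mathcal{C}_k(G)}\operatorname{wg}(C)\prod_{v_i\in V(C)}x_i .$$ Consequently, if $C_k(M)=\sum_{C\in\mathcal{C}_k(G)}\operatorname{wg}(C)$ denotes the total weight of the simple $k$-cycles, then $$C_k(M)=\frac{1}{2k}\,\operatorname{sq}\!\left(\operatorname{tr}\bigl((XM)^k\bigr)\right).$$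
   Context: The weighted adjacency matrix $M=(m_{ij})_{i,j=1}^n$ of $G$ is the symmetric matrix with $m_{ij}=\operatorname{wg}(e)$ if $v_i,v_j$ are joined by an edge $e$, and $m_{ij}=0$ otherwise (in particular $m_{ii}=0$). For a cycle $C$ in $G$, $\operatorname{wg}(C)=\prod_{e\in E(C)}\operatorname{wg}(e)$. For a polynomial $P=\sum_\alpha c_\alpha x^\alpha\in\mathbb{Z}[w,r][x_1,\ldots,x_n]$, its squarefree part is $\operatorname{SF}(P)=\sum_{\alpha\in\{0,1\}^n}c_\alpha x^\alpha$ (delete every monomial divisible by some $x_i^2$), and the squarefree extraction is $\operatorname{sq}(P)=\operatorname{SF}(P)|_{x_1=\cdots=x_n=1}\in\mathbb{Z}[w,r]$, i.e. the sum of the coefficients of all squarefree monomials of $P$. -}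

module Defs where

open import Algebra.Bundles.Raw using (RawMonoid; RawRing; RawSemiring)
import Algebra.Definitions.RawMonoid as RawMonoidOps
import Algebra.Definitions.RawSemiring as RawSemiringOps
open import Data.Fin.Base using (Fin; toℕ)
open import Data.Fin.Patterns using (0F; 1F)
open import Data.Fin.Properties using (_≟_; all?; any?; nonZeroIndex)
open import Data.Integer.Base as ℤ using (ℤ)
open import Data.List.Base as List using (List; []; [_]; allFin; cartesianProductWith; deduplicate; filter; foldr; mapMaybe)
import Data.Maybe.Base as Maybe
open import Data.Nat.Base as ℕ using (ℕ; zero; suc; _≥_; >-nonZero; z≤n; s≤s; _≤_)
open import Data.Nat.DivMod using (_mod_)
import Data.Nat.Properties as ℕₚ
open import Data.Product.Base using (∃; _×_; _,_; map₁)
open import Data.Rational.Base as ℚ using (ℚ)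
open import Data.Sum.Base using (_⊎_)
open import Data.Vec.Base using (Vec; []; _∷_; lookup; replicate; zipWith; _[_]≔_)
open import Data.Vec.Properties using (≡-dec)
open import Data.Vec.Relation.Unary.All as VecAll using (All)
open import Data.Vec.Relation.Unary.AllPairs using (allPairs?)
open import Data.Vec.Relation.Unary.Unique.Propositional using (Unique)
open import Data.Bool.Base using (if_then_else_)
open import Level using (Level; 0ℓ)
open import Relation.Binary.Core using (Rel)
open import Relation.Binary.Definitions using (Decidable; Symmetric; Irreflexive)
open import Relation.Binary.PropositionalEquality.Core using (_≡_)
open import Relation.Nullary.Decidable using (yes; no; does; dec⇒maybe; ¬?; map′; _×-dec_; _⊎-dec_; _→-dec_)
import Relation.Unary as Unary

private
  variable
    c ℓ : Level

-- The ring R[x₁,…,xₙ].  A polynomial is a finite formal sum of terms c·x^α;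
-- an exponent may occur several times, so the coefficient of x^α is the sum
-- over all terms with exponent α, and equality compares all coefficients.
module Polynomial (R : RawRing c ℓ) (n : ℕ) where

  private
    module R where
      open RawRing R public
      open RawSemiringOps rawSemiring public using (_^_; product)

  infix 4 _≈_

  Exponent : Set
  Exponent = Vec ℕ n

  Poly : Set c
  Poly = List (R.Carrier × Exponent)

  coeff : Poly → Exponent → R.Carrier
  coeff P α = foldr (λ (a , β) s → if does (≡-dec ℕₚ._≟_ β α) then a R.+ s else s) R.0# P

  _≈_ : Rel Poly ℓ
  P ≈ Q = ∀ α → coeff P α R.≈ coeff Q α

  const : R.Carrier → Poly
  const a = [ a , replicate n 0 ]

  var : Fin n → Poly
  var i = [ R.1# , replicate n 0 [ i ]≔ 1 ]

  rawRing : RawRing c ℓ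
  rawRing = record
    { Carrier = Poly
    ; _≈_     = _≈_
    ; _+_     = List._++_
    ; _*_     = cartesianProductWith (λ (a , α) (b , β) → a R.* b , zipWith ℕ._+_ α β)
    ; -_      = List.map (map₁ R.-_)
    ; 0#      = []
    ; 1#      = const R.1#
    }

  eval : (Fin n → R.Carrier) → Poly → R.Carrier
  eval ρ = foldr (λ (a , α) s → a R.* R.product (λ i → ρ i R.^ lookup α i) R.+ s) R.0#

  Squarefree : Exponent → Set
  Squarefree = All (_≤ 1)

  squarefree? : Unary.Decidable Squarefree
  squarefree? = VecAll.all? (ℕₚ._≤? 1)

  -- Deleting all terms with a given exponent deletes that monomial, so SF
  -- respects _≈_.
  SF : Poly → Poly
  SF = filter (λ (_ , α) → squarefree? α)

  sq : Poly → R.Carrier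
  sq P = eval (λ _ → R.1#) (SF P)

module Matrix (S : RawSemiring c ℓ) (n : ℕ) where

  private
    module S where
      open RawSemiring S public
      open RawMonoidOps +-rawMonoid public using (sum)

  Mat : Set c
  Mat = Fin n → Fin n → S.Carrier

  diag : (Fin n → S.Carrier) → Mat
  diag d i j = if does (i ≟ j) then d i else S.0#

  tr : Mat → S.Carrier
  tr A = S.sum (λ i → A i i)

  rawSemiring : RawSemiring c ℓ
  rawSemiring = record
    { Carrier = Mat
    ; _≈_     = λ A B → ∀ i j → A i j S.≈ B i j
    ; _+_     = λ A B i j → A i j S.+ B i j
    ; _*_     = λ A B i j → S.sum (λ l → A i l S.* B l j)
    ; 0#      = λ _ _ → S.0#
    ; 1#      = diag (λ _ → S.1#)
    }

  open RawSemiring rawSemiring public using (_*_)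
  open RawSemiringOps rawSemiring public using (_^_)

module ℤ[w,r] where
  open Polynomial ℤ.+-*-rawRing 2 public
  open RawRing rawRing public using (_+_; _*_; 0#; 1#; +-rawMonoid)
  open RawSemiringOps (RawRing.rawSemiring rawRing) public using (product)

  w r : Poly
  w = var 0F
  r = var 1F

module ℚ[w,r] where
  open Polynomial ℚ.+-*-rawRing 2 public
  open RawRing rawRing public using (_+_; _*_; 0#; 1#)

-- The inclusion ℤ[w,r] ⊂ ℚ[w,r].
ι : ℤ[w,r].Poly → ℚ[w,r].Poly
ι = List.map (map₁ (λ a → a ℚ./ 1))

module ℤ[w,r][x] (n : ℕ) where
  open Polynomial ℤ[w,r].rawRing n public
  open RawRing rawRing public using (_+_; _*_; 0#; 1#; rawSemiring; +-rawMonoid)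
  open RawSemiringOps rawSemiring public using (product) renaming (_×_ to _·_)

∑ : (A : RawMonoid c ℓ) {I : Set} → List I → (I → RawMonoid.Carrier A) → RawMonoid.Carrier A
∑ A is f = foldr (λ i s → f i ∙ s) ε is
  where open RawMonoid A

record Graph (n : ℕ) : Set₁ where
  field
    Adj    : Rel (Fin n) 0ℓ
    adj?   : Decidable Adj
    sym    : Symmetric Adj
    irrefl : Irreflexive _≡_ Adj

-- An edge {vᵢ,vⱼ} is given by a proof of Adj i j; wg-sym makes the weight
-- independent of the order of the endpoints, and thereby also of the proof.
record EdgeWeight {n} (G : Graph n) : Set where
  open Graph G
  field
    wg     : ∀ {i j} → Adj i j → ℤ[w,r].Poly
    wg-sym : ∀ {i j} (p : Adj i j) (q : Adj j i) → wg p ℤ[w,r].≈ wg q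

next : ∀ {k} → Fin k → Fin k
next {k} i = (suc (toℕ i) mod k) {{nonZeroIndex i}}

vertexSequences : ∀ n k → List (Vec (Fin n) k)
vertexSequences n zero    = [ [] ]
vertexSequences n (suc k) = cartesianProductWith _∷_ (allFin n) (vertexSequences n k)

module Cycles {n : ℕ} (G : Graph n) (k : ℕ) where
  open Graph G

  -- For k ≥ 3 the sequence (u₀,…,u₍ₖ₋₁₎) traverses the cycle with the k distinct
  -- vertices uᵢ and the k distinct edges {uᵢ,u₍ᵢ₊₁ mod k₎}.
  record IsCycle (us : Vec (Fin n) k) : Set where
    constructor isCycle
    field
      distinct : Unique us
      adjacent : ∀ i → Adj (lookup us i) (lookup us (next i))

  isCycle? : Unary.Decidable IsCycle
  isCycle? us = map′ (λ (d , a) → isCycle d a) (λ (isCycle d a) → d , a)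
    (allPairs? (λ i j → ¬? (i ≟ j)) us ×-dec all? (λ i → adj? (lookup us i) (lookup us (next i))))

  Cycle : Set
  Cycle = ∃ IsCycle

  infix 4 _≋_ _≋?_

  -- {u,v} ∈ E(C)
  EdgeOf : Cycle → Rel (Fin n) 0ℓ
  EdgeOf (us , _) u v = ∃ λ i →
    (lookup us i ≡ u × lookup us (next i) ≡ v) ⊎ (lookup us i ≡ v × lookup us (next i) ≡ u)

  edgeOf? : (C : Cycle) → Decidable (EdgeOf C)
  edgeOf? (us , _) u v = any? λ i →
    (lookup us i ≟ u ×-dec lookup us (next i) ≟ v) ⊎-dec (lookup us i ≟ v ×-dec lookup us (next i) ≟ u)

  -- Two traversals give the same unoriented cycle when they have the same edges
  -- (hence, as every vertex lies on an edge, the same vertices).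
  _≋_ : Rel Cycle 0ℓ
  C ≋ D = ∀ u v → (EdgeOf C u v → EdgeOf D u v) × (EdgeOf D u v → EdgeOf C u v)

  _≋?_ : Decidable _≋_
  C ≋? D = all? λ u → all? λ v →
    (edgeOf? C u v →-dec edgeOf? D u v) ×-dec (edgeOf? D u v →-dec edgeOf? C u v)

  traversals : List Cycle
  traversals = mapMaybe (λ us → Maybe.map (us ,_) (dec⇒maybe (isCycle? us))) (vertexSequences n k)

  -- 𝒞ₖ(G): exactly one traversal of each unoriented cycle.
  𝒞 : List Cycle
  𝒞 = deduplicate _≋?_ traversals

module Weighted {n : ℕ} (G : Graph n) (weight : EdgeWeight G) where
  open Graph G
  open EdgeWeight weight
  open Cycles G public

  private
    module A = ℤ[w,r]
    module B = ℤ[w,r][x] n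

  wg-cycle : ∀ {k} → Cycle k → A.Poly
  wg-cycle (_ , C) = A.product (λ i → wg (IsCycle.adjacent C i))

  -- ∏_{vᵢ ∈ V(C)} xᵢ
  vertexMonomial : ∀ {k} → Cycle k → B.Poly
  vertexMonomial (us , _) = B.product (λ i → B.var (lookup us i))

  totalCycleWeight : ℕ → A.Poly
  totalCycleWeight k = ∑ A.+-rawMonoid (𝒞 k) wg-cycle

  m : Fin n → Fin n → A.Poly
  m i j with adj? i j
  ... | yes p = wg p
  ... | no  _ = A.0#

  open Matrix B.rawSemiring n public

  M X : Mat
  M i j = B.const (m i j)
  X = diag B.var

1/[2*_] : ∀ k → k ≥ 3 → ℚ
1/[2* k ] k≥3 = (ℤ.+ 1 ℚ./ (2 ℕ.* k)) {{ℕₚ.m*n≢0 2 k {{_}} {{>-nonZero (ℕₚ.≤-trans (s≤s z≤n) k≥3)}}}}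

-- The trace of (XM)ᵏ is the sum, over all vertex sequences u₀ … u₍ₖ₋₁₎, of
-- ∏ m(uᵢ,u₍ᵢ₊₁₎) · ∏ x(uᵢ) with indices mod k.  Such a term is squarefree in x exactly
-- when the uᵢ are distinct, and its weight vanishes unless consecutive vertices are
-- adjacent, so SF retains the sum over the traversals of k-cycles.  Two traversals of
-- the same cycle differ by an element of the dihedral group of order 2k, because the
-- direction taken on the first edge determines all later steps; for k ≥ 3 this group
-- acts freely, so every class contributes 2k equal terms.

module Submission where

open import Algebra.Bundles using (CommutativeMonoid; CommutativeSemiring)
open import Algebra.Bundles.Raw using (RawRing)
import Algebra.Definitions.RawMonoid as RawMonoidOps
import Algebra.Definitions.RawSemiring as RawSemiringOps
import Algebra.Properties.CommutativeMonoid.Mult as Mult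
import Algebra.Properties.CommutativeMonoid.Sum as FinSum
import Algebra.Properties.CommutativeSemigroup as CommutativeSemigroupProperties
open import Algebra.Structures using (IsCommutativeRing; IsCommutativeSemiring)
open import Algebra.Structures.Biased using (isCommutativeMonoidˡ; isCommutativeSemiringˡ)
open import Data.Bool.Base using (Bool; true; false; if_then_else_)
open import Data.Empty using (⊥; ⊥-elim)
open import Data.Fin.Base using (Fin; zero; suc; toℕ; fromℕ; inject₁; opposite; splitAt; join)
open import Data.Fin.Induction using (<-weakInduction)
open import Data.Fin.Permutation as Perm using (Permutation′; permutation; _⟨$⟩ʳ_; _⟨$⟩ˡ_; _∘ₚ_)
open import Data.Fin.Properties using (_≟_; toℕ-injective; toℕ-fromℕ<; toℕ-inject₁; toℕ-fromℕ; toℕ<n; toℕ≤pred[n]; opposite-involutive; join-splitAt; splitAt-join; ¬∀⟶∃¬)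
open import Data.Fin.Relation.Unary.Top using (view; ‵fromℕ; ‵inject₁)
open import Data.Integer.Base as ℤ using (+_)
import Data.Integer.Properties as ℤₚ
open import Data.Integer.Tactic.RingSolver using (solve-∀)
open import Data.List.Base as List using (List; []; _∷_; [_]; _++_; allFin; cartesianProductWith; deduplicate; filter; length; map; mapMaybe)
open import Data.List.Membership.Propositional using (_∈_)
open import Data.List.Membership.Propositional.Properties using (∈-++⁺ˡ; ∈-++⁺ʳ; ∈-map⁺; ∈-map⁻; ∈-filter⁺; ∈-filter⁻; ∈-tabulate⁺; ∈-tabulate⁻; ∈-allFin; ∈-cartesianProductWith⁺)
open import Data.List.Membership.Propositional.Properties.WithK using (unique∧set⇒bag)
open import Data.List.Properties using (++-assoc; cartesianProductWith-distribʳ-++; filter-++; filter-accept; filter-reject; length-map; length-tabulate)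
open import Data.List.Relation.Binary.BagAndSetEquality using (∼bag⇒↭)
open import Data.List.Relation.Binary.Permutation.Propositional.Properties using (↭-length)
open import Data.List.Relation.Binary.Subset.Propositional using (_⊆_)
import Data.List.Relation.Unary.All as ListAll
import Data.List.Relation.Unary.AllPairs as ListAllPairs
import Data.List.Relation.Unary.AllPairs.Properties as ListAllPairsₚ
open import Data.List.Relation.Unary.Any using (here; there)
import Data.List.Relation.Unary.Unique.Propositional as ListUnique
import Data.List.Relation.Unary.Unique.Propositional.Properties as ListUniqueₚ
import Data.Maybe.Base as Maybe
open import Data.Nat.Base as ℕ using (ℕ; zero; suc; z≤n; s≤s; _≤_; _<_; _≥_)
open import Data.Nat.DivMod using (_%_; m<n⇒m%n≡m; n%n≡0)
import Data.Nat.Properties as ℕₚ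
open import Data.Product.Base using (∃; _×_; _,_; proj₁; proj₂; uncurry)
open import Data.Rational.Base as ℚ using (fromℚᵘ; toℚᵘ)
import Data.Rational.Properties as ℚₚ
open import Data.Rational.Unnormalised.Base as ℚᵘ using (mkℚᵘ; *≡*)
import Data.Rational.Unnormalised.Properties as ℚᵘₚ
open import Data.Sum.Base using (_⊎_; inj₁; inj₂)
open import Data.Vec.Base as Vec using (Vec; []; _∷_; lookup; replicate; zipWith; _[_]≔_; _∷ʳ_)
open import Data.Vec.Properties using (≡-dec; zipWith-assoc; zipWith-comm; zipWith-identityˡ; lookup-zipWith; lookup∘update; lookup∘update′; lookup-replicate; lookup∘tabulate; tabulate∘lookup; tabulate-cong; ∷-injective)
open import Data.Vec.Relation.Unary.All as VecAll using ([]; _∷_)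
import Data.Vec.Relation.Unary.All.Properties as VecAllₚ
open import Data.Vec.Relation.Unary.AllPairs using ([]; _∷_; allPairs?)
open import Data.Vec.Relation.Unary.Unique.Propositional using (Unique)
open import Data.Vec.Relation.Unary.Unique.Propositional.Properties using (lookup-injective; tabulate⁺)
open import Function.Base using (_∘_; id)
open import Function.Bundles using (mk⇔)
open import Level using (Level; 0ℓ)
open import Relation.Binary.Core using (Rel)
open import Relation.Binary.Definitions using (Decidable; Reflexive; Symmetric; Transitive)
open import Relation.Binary.PropositionalEquality as ≡ using (_≡_; _≢_; cong; cong₂)
open import Relation.Binary.Structures using (IsEquivalence)
open import Relation.Nullary.Decidable using (Dec; yes; no; does; does-⇔; dec⇒maybe; ¬?)
open import Relation.Nullary.Negation using (¬_; contradiction)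
import Relation.Unary as Unary
open import Defs

-- Polynomials are unreduced formal sums, so the ring laws hold only up to equality of coefficients,
-- and every operation has to be shown to respect that equality; `LinearExtension` does so for
-- multiplication and evaluation alike. The result is proved over an arbitrary coefficient ring with
-- commutative semiring laws, because it is needed for ℤ[w,r] over ℤ and again for ℤ[w,r][x] over
-- ℤ[w,r]. The cycles in `𝒞` have no normal form: `deduplicate` keeps whichever traversal of a class
-- it meets first. The passage from traversals to cycles is therefore a statement about any
-- decidable equivalence whose classes have a common size, and only the size 2k involves graphs.
-- Matching the positions of two traversals with the same edges gives an injective `σ` on `Fin k`.
-- If its direction changed at some index, then `σ (next (next i)) ≡ σ i`, which is impossible for k
-- ≥ 3; so `σ` is dihedral. The factor 2k is cancelled only at the very end, separately in each
-- rational coefficient.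

private
  variable
    c ℓ ℓ′ : Level
    I J K : Set

-- Sums over lists

module ListSum (M : CommutativeMonoid c ℓ) where
  open CommutativeMonoid M
  open CommutativeSemigroupProperties commutativeSemigroup using (interchange)
  open import Relation.Binary.Reasoning.Setoid setoid
  open Mult M using (×-distrib-+) renaming (_×_ to _·_)
  open FinSum M using (sum)

  Σ : List I → (I → Carrier) → Carrier
  Σ = ∑ rawMonoid

  infix 8 [_]·_

  [_]·_ : Bool → Carrier → Carrier
  [ b ]· x = if b then x else ε

  []·-cong : ∀ b {x y} → x ≈ y → [ b ]· x ≈ [ b ]· y
  []·-cong true  eq = eq
  []·-cong false eq = refl

  Σ-cong-∈ : ∀ (is : List I) {f g} → (∀ {i} → i ∈ is → f i ≈ g i) → Σ is f ≈ Σ is g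
  Σ-cong-∈ []       eq = refl
  Σ-cong-∈ (i ∷ is) eq = ∙-cong (eq (here ≡.refl)) (Σ-cong-∈ is (eq ∘ there))

  Σ-cong : ∀ (is : List I) {f g} → (∀ i → f i ≈ g i) → Σ is f ≈ Σ is g
  Σ-cong is eq = Σ-cong-∈ is (λ {i} _ → eq i)

  Σ-++ : ∀ (is js : List I) f → Σ (is ++ js) f ≈ Σ is f ∙ Σ js f
  Σ-++ []       js f = sym (identityˡ _)
  Σ-++ (i ∷ is) js f = trans (∙-congˡ (Σ-++ is js f)) (sym (assoc _ _ _))

  Σ-ε : ∀ (is : List I) {f} → (∀ i → f i ≈ ε) → Σ is f ≈ ε
  Σ-ε []       eq = refl
  Σ-ε (i ∷ is) eq = trans (∙-cong (eq i) (Σ-ε is eq)) (identityˡ ε)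

  Σ-distrib : ∀ (is : List I) f g → Σ is (λ i → f i ∙ g i) ≈ Σ is f ∙ Σ is g
  Σ-distrib []       f g = sym (identityˡ ε)
  Σ-distrib (i ∷ is) f g = trans (∙-congˡ (Σ-distrib is f g)) (interchange _ _ _ _)

  Σ-swap : ∀ (is : List I) (js : List J) (f : I → J → Carrier) →
           Σ is (λ i → Σ js (f i)) ≈ Σ js (λ j → Σ is (λ i → f i j))
  Σ-swap []       js f = sym (Σ-ε js (λ _ → refl))
  Σ-swap (i ∷ is) js f = trans (∙-congˡ (Σ-swap is js f)) (sym (Σ-distrib js (f i) _))

  Σ-map : ∀ (h : I → J) is f → Σ (map h is) f ≡ Σ is (f ∘ h)
  Σ-map h []       f = ≡.refl
  Σ-map h (i ∷ is) f = cong (f (h i) ∙_) (Σ-map h is f)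

  Σ-cartesianProductWith : ∀ (h : I → J → K) is js f →
    Σ (cartesianProductWith h is js) f ≈ Σ is (λ i → Σ js (λ j → f (h i j)))
  Σ-cartesianProductWith h []       js f = refl
  Σ-cartesianProductWith h (i ∷ is) js f = trans (Σ-++ (map (h i) js) _ f)
    (∙-cong (reflexive (Σ-map (h i) js f)) (Σ-cartesianProductWith h is js f))

  Σ-tabulate : ∀ {n} (h : Fin n → I) f → Σ (List.tabulate h) f ≡ sum (f ∘ h)
  Σ-tabulate {n = zero}  h f = ≡.refl
  Σ-tabulate {n = suc n} h f = cong (f (h zero) ∙_) (Σ-tabulate (h ∘ suc) f)

  Σ-filter : ∀ {P : Unary.Pred I ℓ′} (P? : Unary.Decidable P) is f →
             Σ (filter P? is) f ≈ Σ is (λ i → [ does (P? i) ]· f i)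
  Σ-filter P? []       f = refl
  Σ-filter P? (i ∷ is) f with P? i
  ... | yes _ = ∙-congˡ (Σ-filter P? is f)
  ... | no  _ = trans (Σ-filter P? is f) (sym (identityˡ _))

  Σ-const : ∀ (is : List I) x → Σ is (λ _ → x) ≡ length is · x
  Σ-const []       x = ≡.refl
  Σ-const (i ∷ is) x = cong (x ∙_) (Σ-const is x)

  Σ-· : ∀ (is : List I) n f → Σ is (λ i → n · f i) ≈ n · Σ is f
  Σ-· []       zero    f = refl
  Σ-· []       (suc n) f = trans (Σ-· [] n f) (sym (identityˡ _))
  Σ-· (i ∷ is) n       f = trans (∙-congˡ (Σ-· is n f)) (sym (×-distrib-+ (f i) _ n))

  module _ {_~_ : Rel I 0ℓ} (_~?_ : Decidable _~_)
           (~-refl : Reflexive _~_) (~-sym : Symmetric _~_) (~-trans : Transitive _~_) where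

    -- Exactly one representative is related to `j`. If it is the head `i`, everything related to
    -- `j` has been filtered out of the rest (`killed`); if not, the filter removes only terms whose
    -- indicator is already zero (`kept`).
    Σ-deduplicate-select : ∀ (is : List I) {j} → j ∈ is → (f : I → Carrier) →
      (∀ {i} → j ~ i → f j ≈ f i) → Σ (deduplicate _~?_ is) (λ i → [ does (j ~? i) ]· f i) ≈ f j
    Σ-deduplicate-select (i ∷ is) {j} j∈ f f-resp = begin
      [ does (j ~? i) ]· f i ∙ Σ (filter (¬? ∘ (i ~?_)) (deduplicate _~?_ is)) F
        ≈⟨ ∙-congˡ (Σ-filter (¬? ∘ (i ~?_)) (deduplicate _~?_ is) F) ⟩
      [ does (j ~? i) ]· f i ∙ Σ (deduplicate _~?_ is) (λ l → [ does (¬? (i ~? l)) ]· F l)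
        ≈⟨ split j∈ ⟩
      f j ∎
      where
      F : I → Carrier
      F l = [ does (j ~? l) ]· f l

      killed : j ~ i → ∀ l → [ does (¬? (i ~? l)) ]· F l ≈ ε
      killed j~i l with i ~? l | j ~? l
      ... | yes _   | _       = refl
      ... | no  i≁l | yes j~l = contradiction (~-trans (~-sym j~i) j~l) i≁l
      ... | no  _   | no  _   = refl

      kept : ¬ j ~ i → ∀ l → [ does (¬? (i ~? l)) ]· F l ≈ F l
      kept j≁i l with i ~? l | j ~? l
      ... | yes i~l | yes j~l = contradiction (~-trans j~l (~-sym i~l)) j≁i
      ... | yes _   | no  _   = refl
      ... | no  _   | _       = refl

      split : j ∈ i ∷ is →
        [ does (j ~? i) ]· f i ∙ Σ (deduplicate _~?_ is) (λ l → [ does (¬? (i ~? l)) ]· F l) ≈ f j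
      split j∈ with j ~? i
      split j∈             | yes j~i =
        trans (∙-cong (sym (f-resp j~i)) (Σ-ε (deduplicate _~?_ is) (killed j~i))) (identityʳ _)
      split (here ≡.refl)  | no  j≁i = contradiction ~-refl j≁i
      split (there j∈is)   | no  j≁i =
        trans (identityˡ _) (trans (Σ-cong (deduplicate _~?_ is) (kept j≁i))
          (Σ-deduplicate-select is j∈is f f-resp))

    -- Double counting: each `f j` is spread over the representatives by an indicator, and after
    -- exchanging the sums the inner one counts the class of a representative.
    Σ-equalClasses : ∀ (is : List I) N (f : I → Carrier) → (∀ {i j} → j ~ i → f j ≈ f i) →
      (∀ i → length (filter (_~? i) is) ≡ N) → Σ is f ≈ N · Σ (deduplicate _~?_ is) f
    Σ-equalClasses is N f f-resp classSize = begin
      Σ is f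
        ≈⟨ Σ-cong-∈ is (λ j∈ → Σ-deduplicate-select is j∈ f f-resp) ⟨
      Σ is (λ j → Σ reps (λ i → [ does (j ~? i) ]· f i))
        ≈⟨ Σ-swap is reps _ ⟩
      Σ reps (λ i → Σ is (λ j → [ does (j ~? i) ]· f i))
        ≈⟨ Σ-cong reps (λ i → trans (sym (Σ-filter (_~? i) is _)) (reflexive (Σ-const (filter (_~? i) is) (f i)))) ⟩
      Σ reps (λ i → length (filter (_~? i) is) · f i)
        ≈⟨ Σ-cong reps (λ i → reflexive (cong (_· f i) (classSize i))) ⟩
      Σ reps (λ i → N · f i)
        ≈⟨ Σ-· reps N f ⟩
      N · Σ reps f ∎
      where
      reps = deduplicate _~?_ is

-- Polynomials as formal sums

CommutativeSemiringLaws : RawRing c ℓ → Set _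
CommutativeSemiringLaws R = IsCommutativeSemiring _≈_ _+_ _*_ 0# 1#
  where open RawRing R

-- The laws derived for polynomials have the same form as those assumed of `R`, so the construction
-- can be iterated.
module PolynomialProperties
  (R : RawRing 0ℓ 0ℓ) (isCommutativeSemiring : CommutativeSemiringLaws R) (n : ℕ) where

  open Polynomial R n

  private
    R-semiring : CommutativeSemiring 0ℓ 0ℓ
    R-semiring = record { isCommutativeSemiring = isCommutativeSemiring }

    module R where
      open CommutativeSemiring R-semiring public
      open RawSemiringOps rawSemiring public using (product; _^_) renaming (_×_ to _·_)

    module P where
      open RawRing rawRing public
      open RawSemiringOps rawSemiring public using (product) renaming (_×_ to _·_)

    module RΣ = ListSum R.+-commutativeMonoid

    _⊕_ : Exponent → Exponent → Exponent
    _⊕_ = zipWith ℕ._+_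

    0ᵉ : Exponent
    0ᵉ = replicate n 0

    ⊕-identityˡ : ∀ α → 0ᵉ ⊕ α ≡ α
    ⊕-identityˡ = zipWith-identityˡ ℕₚ.+-identityˡ

    _≟ᵉ_ : Decidable {A = Exponent} _≡_
    _≟ᵉ_ = ≡-dec ℕₚ._≟_

    δ : Exponent → R.Carrier × Exponent → R.Carrier
    δ γ (a , α) = RΣ.[ does (α ≟ᵉ γ) ]· a

    δ-cong : ∀ γ {a b α β} → a R.≈ b → α ≡ β → δ γ (a , α) R.≈ δ γ (b , β)
    δ-cong γ {α = α} a≈b ≡.refl = RΣ.[]·-cong (does (α ≟ᵉ γ)) a≈b

    δ-+ : ∀ γ a b α → δ γ (a R.+ b , α) R.≈ δ γ (a , α) R.+ δ γ (b , α)
    δ-+ γ a b α with does (α ≟ᵉ γ)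
    ... | true  = R.refl
    ... | false = R.sym (R.+-identityˡ R.0#)

    δ-0 : ∀ γ α → δ γ (R.0# , α) R.≈ R.0#
    δ-0 γ α with does (α ≟ᵉ γ)
    ... | true  = R.refl
    ... | false = R.refl

    δ-* : ∀ γ a b α → δ γ (a R.* b , α) R.≈ a R.* δ γ (b , α)
    δ-* γ a b α with does (α ≟ᵉ γ)
    ... | true  = R.refl
    ... | false = R.sym (R.zeroʳ a)

  exponents : Poly → List Exponent
  exponents = List.map proj₂

  -- A map on formal sums given termwise respects equality of coefficients as soon as it
  -- is additive in the coefficient of each exponent: it can be computed from coeff P.
  module LinearExtension (M : CommutativeMonoid c ℓ)
    (g : R.Carrier → Exponent → CommutativeMonoid.Carrier M)
    (g-cong : ∀ α {a b} → a R.≈ b → CommutativeMonoid._≈_ M (g a α) (g b α))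
    (g-+ : ∀ α a b → CommutativeMonoid._≈_ M (g (a R.+ b) α) (CommutativeMonoid._∙_ M (g a α) (g b α)))
    (g-0 : ∀ α → CommutativeMonoid._≈_ M (g R.0# α) (CommutativeMonoid.ε M))
    where

    private module M = CommutativeMonoid M
    open M using (Carrier; _∙_) renaming (_≈_ to _≈ₘ_)
    open ListSum M
    open import Relation.Binary.Reasoning.Setoid M.setoid

    linear : Poly → Carrier
    linear P = Σ P (uncurry g)

    -- Any list containing the exponents of `P` is allowed, so that two polynomials can be expanded
    -- over one common list and compared there.
    linear-coeff : ∀ P αs → exponents P ⊆ αs →
                   linear P ≈ₘ Σ (deduplicate _≟ᵉ_ αs) (λ β → g (coeff P β) β)
    linear-coeff []            αs P⊆αs = M.sym (Σ-ε (deduplicate _≟ᵉ_ αs) g-0)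
    linear-coeff ((a , α) ∷ P) αs P⊆αs = begin
      g a α ∙ linear P
        ≈⟨ M.∙-cong
             (Σ-deduplicate-select _≟ᵉ_ ≡.refl ≡.sym ≡.trans αs (P⊆αs (here ≡.refl)) (g a)
               (λ α≡β → M.reflexive (cong (g a) α≡β)))
             (M.sym (linear-coeff P αs (P⊆αs ∘ there))) ⟨
      Σ βs (λ β → [ does (α ≟ᵉ β) ]· g a β) ∙ Σ βs (λ β → g (coeff P β) β)
        ≈⟨ Σ-distrib βs _ _ ⟨
      Σ βs (λ β → [ does (α ≟ᵉ β) ]· g a β ∙ g (coeff P β) β)
        ≈⟨ Σ-cong βs addTerm ⟩
      Σ βs (λ β → g (coeff ((a , α) ∷ P) β) β) ∎
      where
      βs = deduplicate _≟ᵉ_ αs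

      addTerm : ∀ β → [ does (α ≟ᵉ β) ]· g a β ∙ g (coeff P β) β ≈ₘ g (coeff ((a , α) ∷ P) β) β
      addTerm β with does (α ≟ᵉ β)
      ... | true  = M.sym (g-+ β a _)
      ... | false = M.identityˡ _

    linear-cong : ∀ {P Q} → P ≈ Q → linear P ≈ₘ linear Q
    linear-cong {P} {Q} P≈Q = begin
      linear P                          ≈⟨ linear-coeff P αs ∈-++⁺ˡ ⟩
      Σ βs (λ β → g (coeff P β) β)      ≈⟨ Σ-cong βs (λ β → g-cong β (P≈Q β)) ⟩
      Σ βs (λ β → g (coeff Q β) β)      ≈⟨ linear-coeff Q αs (∈-++⁺ʳ (exponents P)) ⟨
      linear Q                          ∎
      where
      αs = exponents P ++ exponents Q
      βs = deduplicate _≟ᵉ_ αs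

  coeff-Σ : ∀ P γ → coeff P γ R.≈ RΣ.Σ P (δ γ)
  coeff-Σ []            γ = R.refl
  coeff-Σ ((a , α) ∷ P) γ with does (α ≟ᵉ γ)
  ... | true  = R.+-congˡ (coeff-Σ P γ)
  ... | false = R.trans (coeff-Σ P γ) (R.sym (R.+-identityˡ _))

  coeff-+ : ∀ P Q γ → coeff (P P.+ Q) γ R.≈ coeff P γ R.+ coeff Q γ
  coeff-+ P Q γ = R.trans (coeff-Σ (P ++ Q) γ)
    (R.trans (RΣ.Σ-++ P Q (δ γ)) (R.sym (R.+-cong (coeff-Σ P γ) (coeff-Σ Q γ))))

  coeff-* : ∀ P Q γ → coeff (P P.* Q) γ R.≈
            RΣ.Σ P (λ (a , α) → RΣ.Σ Q (λ (b , β) → δ γ (a R.* b , α ⊕ β)))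
  coeff-* P Q γ = R.trans (coeff-Σ (P P.* Q) γ) (RΣ.Σ-cartesianProductWith _ P Q (δ γ))

  coeff-const-* : ∀ a P γ → coeff (const a P.* P) γ R.≈ a R.* coeff P γ
  coeff-const-* a P γ = begin
    coeff (const a P.* P) γ                             ≈⟨ coeff-* (const a) P γ ⟩
    RΣ.Σ P (λ (b , β) → δ γ (a R.* b , 0ᵉ ⊕ β)) R.+ R.0#  ≈⟨ R.+-identityʳ _ ⟩
    RΣ.Σ P (λ (b , β) → δ γ (a R.* b , 0ᵉ ⊕ β))           ≈⟨ scale P ⟩
    a R.* RΣ.Σ P (δ γ)                                    ≈⟨ R.*-congˡ (coeff-Σ P γ) ⟨
    a R.* coeff P γ                                     ∎
    where
    open import Relation.Binary.Reasoning.Setoid R.setoid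

    scale : ∀ Q → RΣ.Σ Q (λ (b , β) → δ γ (a R.* b , 0ᵉ ⊕ β)) R.≈ a R.* RΣ.Σ Q (δ γ)
    scale []            = R.sym (R.zeroʳ a)
    scale ((b , β) ∷ Q) = R.trans
      (R.+-cong (R.trans (δ-cong γ R.refl (⊕-identityˡ β)) (δ-* γ a b β)) (scale Q))
      (R.sym (R.distribˡ a _ _))

  private
    *-comm : ∀ P Q → P P.* Q ≈ Q P.* P
    *-comm P Q γ = R.trans (coeff-* P Q γ) (R.trans (RΣ.Σ-swap P Q _) (R.trans
      (RΣ.Σ-cong Q (λ (b , β) → RΣ.Σ-cong P (λ (a , α) →
        δ-cong γ (R.*-comm a b) (zipWith-comm ℕₚ.+-comm α β))))
      (R.sym (coeff-* Q P γ))))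

    -- For fixed `Q` and `γ` the coefficient of the product is additive in the coefficient of each
    -- exponent of `P`.
    *-congʳ : ∀ Q {P P′} → P ≈ P′ → P P.* Q ≈ P′ P.* Q
    *-congʳ Q {P} {P′} P≈P′ γ =
      R.trans (coeff-* P Q γ) (R.trans (linear-cong {P} {P′} P≈P′) (R.sym (coeff-* P′ Q γ)))
      where
      open LinearExtension R.+-commutativeMonoid
        (λ a α → RΣ.Σ Q (λ (b , β) → δ γ (a R.* b , α ⊕ β)))
        (λ α a≈b → RΣ.Σ-cong Q (λ (b , β) → δ-cong γ {α = α ⊕ β} (R.*-congʳ a≈b) ≡.refl))
        (λ α a a′ → R.trans
          (RΣ.Σ-cong Q (λ (b , β) → R.trans
            (δ-cong γ {α = α ⊕ β} (R.distribʳ b a a′) ≡.refl) (δ-+ γ _ _ (α ⊕ β))))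
          (RΣ.Σ-distrib Q _ _))
        (λ α → RΣ.Σ-ε Q (λ (b , β) → R.trans
          (δ-cong γ {α = α ⊕ β} (R.zeroˡ b) ≡.refl) (δ-0 γ (α ⊕ β))))

    *-cong : ∀ {P P′ Q Q′} → P ≈ P′ → Q ≈ Q′ → P P.* Q ≈ P′ P.* Q′
    *-cong {P} {P′} {Q} {Q′} P≈P′ Q≈Q′ γ = R.trans (*-congʳ Q {P} {P′} P≈P′ γ)
      (R.trans (*-comm P′ Q γ) (R.trans (*-congʳ P′ {Q} {Q′} Q≈Q′ γ) (*-comm Q′ P′ γ)))

    *-assoc : ∀ P Q S → (P P.* Q) P.* S ≈ P P.* (Q P.* S)
    *-assoc P Q S γ = begin
      coeff ((P P.* Q) P.* S) γ
        ≈⟨ coeff-* (P P.* Q) S γ ⟩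
      RΣ.Σ (P P.* Q) (λ (a , α) → RΣ.Σ S (λ (b , β) → δ γ (a R.* b , α ⊕ β)))
        ≈⟨ RΣ.Σ-cartesianProductWith _ P Q _ ⟩
      RΣ.Σ P (λ (a , α) → RΣ.Σ Q (λ (b , β) → RΣ.Σ S (λ (c , χ) → δ γ ((a R.* b) R.* c , (α ⊕ β) ⊕ χ))))
        ≈⟨ RΣ.Σ-cong P (λ (a , α) → RΣ.Σ-cong Q (λ (b , β) → RΣ.Σ-cong S (λ (c , χ) →
             δ-cong γ (R.*-assoc a b c) (zipWith-assoc ℕₚ.+-assoc α β χ)))) ⟩
      RΣ.Σ P (λ (a , α) → RΣ.Σ Q (λ (b , β) → RΣ.Σ S (λ (c , χ) → δ γ (a R.* (b R.* c) , α ⊕ (β ⊕ χ)))))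
        ≈⟨ RΣ.Σ-cong P (λ _ → RΣ.Σ-cartesianProductWith _ Q S _) ⟨
      RΣ.Σ P (λ (a , α) → RΣ.Σ (Q P.* S) (λ (b , β) → δ γ (a R.* b , α ⊕ β)))
        ≈⟨ coeff-* P (Q P.* S) γ ⟨
      coeff (P P.* (Q P.* S)) γ ∎
      where open import Relation.Binary.Reasoning.Setoid R.setoid

  poly-isCommutativeSemiring : IsCommutativeSemiring _≈_ P._+_ P._*_ P.0# P.1#
  poly-isCommutativeSemiring = isCommutativeSemiringˡ record
    { +-isCommutativeMonoid = isCommutativeMonoidˡ record
      { isSemigroup = record
        { isMagma = record
          { isEquivalence = ≈-isEquivalence
          ; ∙-cong = λ {P} {P′} {Q} {Q′} P≈P′ Q≈Q′ γ → R.trans (coeff-+ P Q γ)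
              (R.trans (R.+-cong (P≈P′ γ) (Q≈Q′ γ)) (R.sym (coeff-+ P′ Q′ γ)))
          }
        ; assoc = λ P Q S γ → R.reflexive (cong (λ T → coeff T γ) (++-assoc P Q S))
        }
      ; identityˡ = λ P γ → R.refl
      ; comm = λ P Q γ → R.trans (coeff-+ P Q γ) (R.trans (R.+-comm _ _) (R.sym (coeff-+ Q P γ)))
      }
    ; *-isCommutativeMonoid = isCommutativeMonoidˡ record
      { isSemigroup = record
        { isMagma = record
          { isEquivalence = ≈-isEquivalence
          ; ∙-cong = λ {P} {P′} {Q} {Q′} → *-cong {P} {P′} {Q} {Q′}
          }
        ; assoc = *-assoc
        }
      ; identityˡ = λ P γ → R.trans (coeff-const-* R.1# P γ) (R.*-identityˡ _)
      ; comm = *-comm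
      }
    ; distribʳ = λ P Q S γ → R.reflexive (cong (λ T → coeff T γ) (cartesianProductWith-distribʳ-++ _ Q S P))
    ; zeroˡ = λ P γ → R.refl
    }
    where
    ≈-isEquivalence : IsEquivalence _≈_
    ≈-isEquivalence = record
      { refl  = λ γ → R.refl
      ; sym   = λ P≈Q γ → R.sym (P≈Q γ)
      ; trans = λ P≈Q Q≈S γ → R.trans (P≈Q γ) (Q≈S γ)
      }

  commutativeSemiring : CommutativeSemiring 0ℓ 0ℓ
  commutativeSemiring = record { isCommutativeSemiring = poly-isCommutativeSemiring }

  -- Squarefree part and evaluation

  SF-+ : ∀ P Q → SF (P P.+ Q) ≡ SF P P.+ SF Q
  SF-+ = filter-++ _

  coeff-SF : ∀ P γ → coeff (SF P) γ R.≈ RΣ.[ does (squarefree? γ) ]· coeff P γ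
  coeff-SF P γ = begin
    coeff (SF P) γ                                                        ≈⟨ coeff-Σ (SF P) γ ⟩
    RΣ.Σ (SF P) (δ γ)                                                     ≈⟨ RΣ.Σ-filter _ P (δ γ) ⟩
    RΣ.Σ P (λ (a , α) → RΣ.[ does (squarefree? α) ]· δ γ (a , α))         ≈⟨ RΣ.Σ-cong P transfer ⟩
    RΣ.Σ P (λ (a , α) → RΣ.[ does (squarefree? γ) ]· δ γ (a , α))         ≈⟨ factor (does (squarefree? γ)) ⟩
    RΣ.[ does (squarefree? γ) ]· RΣ.Σ P (δ γ)                             ≈⟨ RΣ.[]·-cong (does (squarefree? γ)) (coeff-Σ P γ) ⟨
    RΣ.[ does (squarefree? γ) ]· coeff P γ                                ∎
    where
    open import Relation.Binary.Reasoning.Setoid R.setoid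

    []·-0 : ∀ b → RΣ.[ b ]· R.0# R.≈ R.0#
    []·-0 true  = R.refl
    []·-0 false = R.refl

    -- Terms with `α` different from `γ` contribute nothing, so the test on the varying exponent may
    -- be replaced by the test on the fixed one.
    transfer : ∀ ((a , α) : R.Carrier × Exponent) →
      RΣ.[ does (squarefree? α) ]· δ γ (a , α) R.≈ RΣ.[ does (squarefree? γ) ]· δ γ (a , α)
    transfer (a , α) with α ≟ᵉ γ
    ... | yes ≡.refl = R.refl
    ... | no  _      = R.trans ([]·-0 (does (squarefree? α))) (R.sym ([]·-0 (does (squarefree? γ))))

    factor : ∀ b → RΣ.Σ P (λ t → RΣ.[ b ]· δ γ t) R.≈ RΣ.[ b ]· RΣ.Σ P (δ γ)
    factor true  = R.refl
    factor false = RΣ.Σ-ε P (λ _ → R.refl)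

  SF-cong : ∀ {P Q} → P ≈ Q → SF P ≈ SF Q
  SF-cong {P} {Q} P≈Q γ = R.trans (coeff-SF P γ)
    (R.trans (RΣ.[]·-cong (does (squarefree? γ)) (P≈Q γ)) (R.sym (coeff-SF Q γ)))

  SF-∑ : ∀ (is : List I) F → SF (∑ P.+-rawMonoid is F) ≡ ∑ P.+-rawMonoid is (SF ∘ F)
  SF-∑ []       F = ≡.refl
  SF-∑ (i ∷ is) F = ≡.trans (SF-+ (F i) _) (cong (SF (F i) ++_) (SF-∑ is F))

  eval-cong : ∀ ρ {P Q} → P ≈ Q → eval ρ P R.≈ eval ρ Q
  eval-cong ρ {P} {Q} = linear-cong {P} {Q}
    where
    open LinearExtension R.+-commutativeMonoid
      (λ a α → a R.* R.product (λ i → ρ i R.^ lookup α i))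
      (λ α → R.*-congʳ)
      (λ α → R.distribʳ _)
      (λ α → R.zeroˡ _)

  eval-+ : ∀ ρ P Q → eval ρ (P P.+ Q) R.≈ eval ρ P R.+ eval ρ Q
  eval-+ ρ P Q = RΣ.Σ-++ P Q _

  eval-∑ : ∀ ρ (is : List I) F → eval ρ (∑ P.+-rawMonoid is F) R.≈ RΣ.Σ is (eval ρ ∘ F)
  eval-∑ ρ []       F = R.refl
  eval-∑ ρ (i ∷ is) F = R.trans (eval-+ ρ (F i) _) (R.+-congˡ (eval-∑ ρ is F))

  eval-· : ∀ ρ m P → eval ρ (m P.· P) R.≈ m R.· eval ρ P
  eval-· ρ zero    P = R.refl
  eval-· ρ (suc m) P = R.trans (eval-+ ρ P _) (R.+-congˡ (eval-· ρ m P))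

  coeff-· : ∀ m P γ → coeff (m P.· P) γ R.≈ m R.· coeff P γ
  coeff-· zero    P γ = R.refl
  coeff-· (suc m) P γ = R.trans (coeff-+ P _ γ) (R.+-congˡ (coeff-· m P γ))

  -- Constants and monomials

  const-cong : ∀ {a b} → a R.≈ b → const a ≈ const b
  const-cong a≈b γ with does (0ᵉ ≟ᵉ γ)
  ... | true  = R.+-congʳ a≈b
  ... | false = R.refl

  -- The left side still consists of one term, with coefficient zero, while the right side is the
  -- empty sum; they agree only in their coefficients.
  const-0 : const R.0# ≈ P.0#
  const-0 γ with does (0ᵉ ≟ᵉ γ)
  ... | true  = R.+-identityʳ R.0#
  ... | false = R.refl

  const-* : ∀ a b → const (a R.* b) ≡ const a P.* const b
  const-* a b = cong (λ α → [ a R.* b , α ]) (≡.sym (⊕-identityˡ 0ᵉ))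

  const-product : ∀ {k} (f : Fin k → R.Carrier) → const (R.product f) ≡ P.product (const ∘ f)
  const-product {zero}  f = ≡.refl
  const-product {suc k} f = ≡.trans (const-* (f zero) _) (cong (const (f zero) P.*_) (const-product (f ∘ suc)))

  private
    product-1 : ∀ {k} (f : Fin k → R.Carrier) → (∀ i → f i R.≈ R.1#) → R.product f R.≈ R.1#
    product-1 {zero}  f f≈1 = R.refl
    product-1 {suc k} f f≈1 = R.trans (R.*-cong (f≈1 zero) (product-1 (f ∘ suc) (f≈1 ∘ suc))) (R.*-identityˡ R.1#)

    1^n≈1 : ∀ e → R.1# R.^ e R.≈ R.1#
    1^n≈1 zero    = R.refl
    1^n≈1 (suc e) = R.trans (R.*-identityˡ _) (1^n≈1 e)

  -- The exponent of xᵤ₀ ⋯ xᵤ₍ₖ₋₁₎.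
  multiplicities : ∀ {k} → Vec (Fin n) k → Exponent
  multiplicities []       = 0ᵉ
  multiplicities (u ∷ us) = (0ᵉ [ u ]≔ 1) ⊕ multiplicities us

  -- The product of ones is left unsimplified, which keeps this a propositional equality; `SF` looks
  -- only at the exponent and can be computed after rewriting.
  product-var : ∀ {k} (us : Vec (Fin n) k) →
    P.product (λ i → var (lookup us i)) ≡ [ R.product {k} (λ _ → R.1#) , multiplicities us ]
  product-var []       = ≡.refl
  product-var (u ∷ us) = cong (var u P.*_) (product-var us)

  monomial : ∀ a {k} (us : Vec (Fin n) k) → const a P.* P.product (λ i → var (lookup us i)) ≡
             [ a R.* R.product {k} (λ _ → R.1#) , multiplicities us ]
  monomial a us = ≡.trans (cong (const a P.*_) (product-var us))
    (cong (λ α → [ a R.* _ , α ]) (⊕-identityˡ (multiplicities us)))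

  eval-1-monomial : ∀ a {k} (us : Vec (Fin n) k) →
    eval (λ _ → R.1#) (const a P.* P.product (λ i → var (lookup us i))) R.≈ a
  eval-1-monomial a {k} us = R.trans
    (R.reflexive (cong (eval (λ _ → R.1#)) (monomial a us)))
    (R.trans (R.+-identityʳ _)
    (R.trans (R.*-cong (R.trans (R.*-congˡ (product-1 {k} _ (λ _ → R.refl))) (R.*-identityʳ a))
      (product-1 _ (λ i → 1^n≈1 (lookup (multiplicities us) i)))) (R.*-identityʳ a)))

  private
    lookup-multiplicities-head : ∀ u {k} (us : Vec (Fin n) k) →
      lookup (multiplicities (u ∷ us)) u ≡ suc (lookup (multiplicities us) u)
    lookup-multiplicities-head u us = ≡.trans (lookup-zipWith ℕ._+_ u (0ᵉ [ u ]≔ 1) (multiplicities us))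
      (cong (ℕ._+ lookup (multiplicities us) u) (lookup∘update u 0ᵉ 1))

    lookup-multiplicities-tail : ∀ {u v} {k} (us : Vec (Fin n) k) → v ≢ u →
      lookup (multiplicities (u ∷ us)) v ≡ lookup (multiplicities us) v
    lookup-multiplicities-tail {u} {v} us v≢u = ≡.trans (lookup-zipWith ℕ._+_ v (0ᵉ [ u ]≔ 1) (multiplicities us))
      (cong (ℕ._+ lookup (multiplicities us) v) (≡.trans (lookup∘update′ v≢u 0ᵉ 1) (lookup-replicate v 0)))

    multiplicity-0⁺ : ∀ {v k} {us : Vec (Fin n) k} → VecAll.All (v ≢_) us → lookup (multiplicities us) v ≡ 0
    multiplicity-0⁺ {v} []            = lookup-replicate v 0
    multiplicity-0⁺ {us = u ∷ us} (v≢u ∷ v∉us) = ≡.trans (lookup-multiplicities-tail us v≢u) (multiplicity-0⁺ v∉us)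

    multiplicity-0⁻ : ∀ {v k} (us : Vec (Fin n) k) → lookup (multiplicities us) v ≡ 0 → VecAll.All (v ≢_) us
    multiplicity-0⁻ []       eq = []
    multiplicity-0⁻ {v} (u ∷ us) eq = v≢u ∷ multiplicity-0⁻ us (≡.trans (≡.sym (lookup-multiplicities-tail us v≢u)) eq)
      where
      v≢u : v ≢ u
      v≢u ≡.refl with () ← ≡.trans (≡.sym (lookup-multiplicities-head v us)) eq

  -- Component `v` of the exponent counts the occurrences of `v` in `us`; a head that does not recur
  -- is counted once.
  squarefree-multiplicities⁺ : ∀ {k} {us : Vec (Fin n) k} → Unique us → Squarefree (multiplicities us)
  squarefree-multiplicities⁺ = VecAllₚ.lookup⁻ ∘ bound
    where
    bound : ∀ {k} {us : Vec (Fin n) k} → Unique us → ∀ v → lookup (multiplicities us) v ≤ 1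
    bound [] v = ℕₚ.≤-trans (ℕₚ.≤-reflexive (lookup-replicate v 0)) z≤n
    bound {us = u ∷ us} (u∉us ∷ us!) v with v ≟ u
    ... | yes ≡.refl = ℕₚ.≤-reflexive (≡.trans (lookup-multiplicities-head u us) (cong suc (multiplicity-0⁺ u∉us)))
    ... | no  v≢u    = ℕₚ.≤-trans (ℕₚ.≤-reflexive (lookup-multiplicities-tail us v≢u)) (bound us! v)

  squarefree-multiplicities⁻ : ∀ {k} (us : Vec (Fin n) k) → Squarefree (multiplicities us) → Unique us
  squarefree-multiplicities⁻ us sf = go us (VecAllₚ.lookup⁺ sf)
    where
    go : ∀ {k} (us : Vec (Fin n) k) → (∀ v → lookup (multiplicities us) v ≤ 1) → Unique us
    go []       bound = []
    go (u ∷ us) bound = multiplicity-0⁻ us (ℕₚ.n≤0⇒n≡0 (ℕₚ.≤-pred (≡.subst (_≤ 1) (lookup-multiplicities-head u us) (bound u))))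
      ∷ go us (λ v → ℕₚ.≤-trans (ℕₚ.m≤n+m _ _) (≡.subst (_≤ 1) (lookup-zipWith ℕ._+_ v (0ᵉ [ u ]≔ 1) (multiplicities us)) (bound v)))

  SF-monomial-unique : ∀ a {k} (us : Vec (Fin n) k) → Unique us →
    let t = const a P.* P.product (λ i → var (lookup us i)) in SF t ≡ t
  SF-monomial-unique a us us! rewrite monomial a us =
    filter-accept (λ (_ , α) → squarefree? α) (squarefree-multiplicities⁺ us!)

  SF-monomial-¬unique : ∀ a {k} (us : Vec (Fin n) k) → ¬ Unique us →
    SF (const a P.* P.product (λ i → var (lookup us i))) ≡ P.0#
  SF-monomial-¬unique a us ¬us! rewrite monomial a us =
    filter-reject (λ (_ , α) → squarefree? α) (¬us! ∘ squarefree-multiplicities⁻ us)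

-- Symmetries of the cyclic order on Fin k

toℕ-next : ∀ {k} (i : Fin (suc k)) → toℕ i < k → toℕ (next i) ≡ suc (toℕ i)
toℕ-next i i<k = ≡.trans (toℕ-fromℕ< _) (m<n⇒m%n≡m (s≤s i<k))

-- With `next-fromℕ`, this replaces arithmetic modulo the length by a case split on whether the
-- index is the last one.
next-inject₁ : ∀ {k} (i : Fin k) → next (inject₁ i) ≡ suc i
next-inject₁ {k} i = toℕ-injective (≡.trans
  (toℕ-next (inject₁ i) (≡.subst (_< k) (≡.sym (toℕ-inject₁ i)) (toℕ<n i)))
  (cong suc (toℕ-inject₁ i)))

next-fromℕ : ∀ k → next (fromℕ k) ≡ zero
next-fromℕ k = toℕ-injective (≡.trans (toℕ-fromℕ< _)
  (≡.trans (cong (λ m → suc m % suc k) (toℕ-fromℕ k)) (n%n≡0 (suc k))))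

opposite-inject₁ : ∀ {k} (i : Fin k) → opposite (inject₁ i) ≡ suc (opposite i)
opposite-inject₁ zero    = ≡.refl
opposite-inject₁ (suc i) = cong inject₁ (opposite-inject₁ i)

-- The dihedral relation: reversal conjugates `next` into its inverse. Hence the inverse chosen in
-- `nextₚ` and the behaviour of reflections.
next-opposite-next : ∀ {k} (i : Fin k) → next (opposite (next i)) ≡ opposite i
next-opposite-next {suc k} i with view i
... | ‵fromℕ     = begin
  next (opposite (next (fromℕ k)))  ≡⟨ cong (next ∘ opposite) (next-fromℕ k) ⟩
  next (fromℕ k)                    ≡⟨ next-fromℕ k ⟩
  zero                              ≡⟨ opposite-involutive zero ⟨
  opposite (fromℕ k)                ∎
  where open ≡.≡-Reasoning
... | ‵inject₁ j = begin
  next (opposite (next (inject₁ j)))  ≡⟨ cong (next ∘ opposite) (next-inject₁ j) ⟩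
  next (inject₁ (opposite j))         ≡⟨ next-inject₁ (opposite j) ⟩
  suc (opposite j)                    ≡⟨ opposite-inject₁ j ⟨
  opposite (inject₁ j)                ∎
  where open ≡.≡-Reasoning

nextₚ : ∀ {k} → Permutation′ k
nextₚ = permutation next (opposite ∘ next ∘ opposite)
  (λ i → ≡.trans (next-opposite-next (opposite i)) (opposite-involutive i))
  (λ i → ≡.trans (cong opposite (next-opposite-next i)) (opposite-involutive i))

⟨$⟩ʳ-injective : ∀ {k} (π : Permutation′ k) {i j} → π ⟨$⟩ʳ i ≡ π ⟨$⟩ʳ j → i ≡ j
⟨$⟩ʳ-injective π eq = ≡.trans (≡.sym (Perm.inverseˡ π)) (≡.trans (cong (π ⟨$⟩ˡ_) eq) (Perm.inverseˡ π))

next-injective : ∀ {k} {i j : Fin k} → next i ≡ next j → i ≡ j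
next-injective = ⟨$⟩ʳ-injective nextₚ

rotation : ∀ {k} → ℕ → Permutation′ k
rotation zero    = Perm.id
rotation (suc s) = rotation s ∘ₚ nextₚ

rotation-next : ∀ {k} s (i : Fin k) → rotation s ⟨$⟩ʳ next i ≡ next (rotation s ⟨$⟩ʳ i)
rotation-next zero    i = ≡.refl
rotation-next (suc s) i = cong next (rotation-next s i)

-- Up to `s ≤ k` no step wraps around, so each one raises the index by exactly one.
toℕ-rotation-zero : ∀ {k} s → s ≤ k → toℕ (rotation {suc k} s ⟨$⟩ʳ zero) ≡ s
toℕ-rotation-zero zero    s≤k = ≡.refl
toℕ-rotation-zero (suc s) s<k = ≡.trans
  (toℕ-next _ (≡.subst (_< _) (≡.sym IH) s<k)) (cong suc IH)
  where IH = toℕ-rotation-zero s (ℕₚ.<⇒≤ s<k)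

rotation-zero : ∀ {k} (i : Fin (suc k)) → rotation (toℕ i) ⟨$⟩ʳ zero ≡ i
rotation-zero i = toℕ-injective (toℕ-rotation-zero (toℕ i) (toℕ≤pred[n] i))

-- The source of both freeness and a constant direction: on one or two indices `next ∘ next` is the
-- identity. Rotations commute with `next`, so the claim moves to index zero, where it is decided by
-- computation.
next²≢id : ∀ {k} → k ≥ 3 → (i : Fin k) → next (next i) ≢ i
next²≢id {suc (suc (suc k))} (s≤s (s≤s (s≤s _))) i eq =
  contradiction (⟨$⟩ʳ-injective (rotation (toℕ i)) {next (next zero)} {zero} turned) λ ()
  where
  open ≡.≡-Reasoning

  turned : rotation (toℕ i) ⟨$⟩ʳ next (next zero) ≡ rotation (toℕ i) ⟨$⟩ʳ zero
  turned = begin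
    rotation (toℕ i) ⟨$⟩ʳ next (next zero)    ≡⟨ rotation-next (toℕ i) (next zero) ⟩
    next (rotation (toℕ i) ⟨$⟩ʳ next zero)    ≡⟨ cong next (rotation-next (toℕ i) zero) ⟩
    next (next (rotation (toℕ i) ⟨$⟩ʳ zero))  ≡⟨ cong (next ∘ next) (rotation-zero i) ⟩
    next (next i)                             ≡⟨ eq ⟩
    i                                         ≡⟨ rotation-zero i ⟨
    rotation (toℕ i) ⟨$⟩ʳ zero                ∎

-- From zero, `next` reaches every index before it wraps around.
next-induction : ∀ {k} (P : Fin (suc k) → Set) → P zero → (∀ i → P i → P (next i)) → ∀ i → P i
next-induction P P0 step = <-weakInduction P P0 λ i Pi → ≡.subst P (next-inject₁ i) (step (inject₁ i) Pi)

-- i ↦ i + s and i ↦ s - 1 - i, modulo k.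
dihedral : ∀ {k} → Fin k ⊎ Fin k → Permutation′ k
dihedral (inj₁ s) = rotation (toℕ s)
dihedral (inj₂ s) = Perm.reverse ∘ₚ rotation (toℕ s)

-- `Reflects` is σ(i+1) = σ(i) - 1 with the subtraction moved to the left, which avoids the inverse
-- of `next`.
Rotates Reflects : ∀ {k} → (Fin k → Fin k) → Set
Rotates  σ = ∀ i → σ (next i) ≡ next (σ i)
Reflects σ = ∀ i → next (σ (next i)) ≡ σ i

reflection-reflects : ∀ {k} (s : Fin k) → Reflects (dihedral (inj₂ s) ⟨$⟩ʳ_)
reflection-reflects s i = ≡.trans
  (≡.sym (rotation-next (toℕ s) (opposite (next i))))
  (cong (rotation (toℕ s) ⟨$⟩ʳ_) (next-opposite-next i))

dihedral-step : ∀ {k} (e : Fin k ⊎ Fin k) → Rotates (dihedral e ⟨$⟩ʳ_) ⊎ Reflects (dihedral e ⟨$⟩ʳ_)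
dihedral-step (inj₁ s) = inj₁ (rotation-next (toℕ s))
dihedral-step (inj₂ s) = inj₂ (reflection-reflects s)

rotates⇒rotation : ∀ {k} (σ : Fin (suc k) → Fin (suc k)) → Rotates σ →
                   ∃ λ s → ∀ i → σ i ≡ rotation (toℕ s) ⟨$⟩ʳ i
rotates⇒rotation σ rot = σ zero , next-induction _ (≡.sym (rotation-zero (σ zero))) λ i eq →
  ≡.trans (rot i) (≡.trans (cong next eq) (≡.sym (rotation-next (toℕ (σ zero)) i)))

module _ {k} (k≥3 : k ≥ 3) (σ : Fin k → Fin k) (σ-injective : ∀ {i j} → σ i ≡ σ j → i ≡ j) where

  -- Stepping forward and then backward gives `σ (next (next i)) ≡ σ i`; the `Fin k` argument
  -- supplies the index `i`.
  ¬rotates∧reflects : Fin k → Rotates σ → Reflects σ → ⊥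
  ¬rotates∧reflects i rot ref = next²≢id k≥3 i (σ-injective (≡.trans (rot (next i)) (ref i)))

  module _ (step : ∀ i → (σ (next i) ≡ next (σ i)) ⊎ (next (σ (next i)) ≡ σ i)) where

    -- Turning back at `next i` would give `next (next i)` and `i` the same image.
    rotates-next : ∀ i → σ (next i) ≡ next (σ i) → σ (next (next i)) ≡ next (σ (next i))
    rotates-next i eq with step (next i)
    ... | inj₁ eq′ = eq′
    ... | inj₂ eq′ = contradiction (σ-injective (next-injective (≡.trans eq′ eq))) (next²≢id k≥3 i)

    reflects-next : ∀ i → next (σ (next i)) ≡ σ i → next (σ (next (next i))) ≡ σ (next i)
    reflects-next i eq with step (next i)
    ... | inj₁ eq′ = contradiction (σ-injective (≡.trans eq′ eq)) (next²≢id k≥3 i)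
    ... | inj₂ eq′ = eq′

steps⇒dihedral : ∀ {k} → k ≥ 3 → (σ : Fin k → Fin k) → (∀ {i j} → σ i ≡ σ j → i ≡ j) →
  (∀ i → (σ (next i) ≡ next (σ i)) ⊎ (next (σ (next i)) ≡ σ i)) →
  ∃ λ e → ∀ i → σ i ≡ dihedral e ⟨$⟩ʳ i
steps⇒dihedral {suc k} k≥3 σ σ-injective step with step zero
... | inj₁ eq =
  let s , σ≗ = rotates⇒rotation σ (next-induction _ eq (rotates-next k≥3 σ σ-injective step))
  in inj₁ s , σ≗
... | inj₂ eq =
  let reflects = next-induction _ eq (reflects-next k≥3 σ σ-injective step)
      -- Reversing the argument turns a reflection into a map commuting with `next`; its rotation
      -- amount is the required parameter.
      s , τ≗   = rotates⇒rotation (σ ∘ opposite) λ i →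
        ≡.trans (≡.sym (reflects (opposite (next i)))) (cong (next ∘ σ) (next-opposite-next i))
  in inj₂ s , λ i → ≡.trans (cong σ (≡.sym (opposite-involutive i))) (τ≗ (opposite i))

rotation≢reflection : ∀ {k} → k ≥ 3 → (s t : Fin k) →
  ¬ (∀ i → dihedral (inj₁ s) ⟨$⟩ʳ i ≡ dihedral (inj₂ t) ⟨$⟩ʳ i)
rotation≢reflection k≥3 s t eq = ¬rotates∧reflects k≥3 (dihedral (inj₁ s) ⟨$⟩ʳ_)
  (⟨$⟩ʳ-injective (dihedral (inj₁ s))) s (rotation-next (toℕ s))
  λ i → ≡.trans (cong next (eq (next i))) (≡.trans (reflection-reflects t i) (≡.sym (eq i)))

-- A rotation is recovered from its value at zero, a reflection likewise once the reversal is
-- undone, and the two kinds never coincide.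
dihedral-injective : ∀ {k} → k ≥ 3 → (e f : Fin k ⊎ Fin k) →
  (∀ i → dihedral e ⟨$⟩ʳ i ≡ dihedral f ⟨$⟩ʳ i) → e ≡ f
dihedral-injective {suc k} k≥3 (inj₁ s) (inj₁ t) eq = cong inj₁
  (≡.trans (≡.sym (rotation-zero s)) (≡.trans (eq zero) (rotation-zero t)))
dihedral-injective {suc k} k≥3 (inj₂ s) (inj₂ t) eq = cong inj₂
  (≡.trans (≡.sym (rotation-zero s)) (≡.trans (eq′ zero) (rotation-zero t)))
  where
  eq′ : ∀ i → rotation (toℕ s) ⟨$⟩ʳ i ≡ rotation (toℕ t) ⟨$⟩ʳ i
  eq′ i = ≡.subst (λ j → rotation (toℕ s) ⟨$⟩ʳ j ≡ rotation (toℕ t) ⟨$⟩ʳ j)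
    (opposite-involutive i) (eq (opposite i))
dihedral-injective k≥3 (inj₁ s) (inj₂ t) eq = ⊥-elim (rotation≢reflection k≥3 s t eq)
dihedral-injective k≥3 (inj₂ s) (inj₁ t) eq = ⊥-elim (rotation≢reflection k≥3 t s (≡.sym ∘ eq))

-- Traversals of a cycle

reindex : ∀ {A : Set} {k} → Vec A k → Permutation′ k → Vec A k
reindex us π = Vec.tabulate (λ i → lookup us (π ⟨$⟩ʳ i))

lookup-reindex : ∀ {A : Set} {k} (us : Vec A k) π i → lookup (reindex us π) i ≡ lookup us (π ⟨$⟩ʳ i)
lookup-reindex us π = lookup∘tabulate _

module _ (M : CommutativeMonoid c ℓ) where
  open CommutativeMonoid M
  open FinSum M using (sum; sum-cong-≋; sum-permute)

  sum-reindex : ∀ {A : Set} {k} (f : A → Carrier) (us : Vec A k) π →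
    sum (λ i → f (lookup (reindex us π) i)) ≈ sum (λ i → f (lookup us i))
  sum-reindex {k = k} f us π = trans
    (sum-cong-≋ {k} (λ i → reflexive (cong f (lookup-reindex us π i))))
    (sym (sum-permute _ π))

  -- Stated for any commutative monoid; in the application it is multiplicative and `sum` is the
  -- product of the edge weights.
  sum-next-dihedral : ∀ {A : Set} {k} (w : A → A → Carrier) → (∀ u v → w u v ≈ w v u) →
    (us : Vec A k) (e : Fin k ⊎ Fin k) → let vs = reindex us (dihedral e) in
    sum (λ i → w (lookup vs i) (lookup vs (next i))) ≈ sum (λ i → w (lookup us i) (lookup us (next i)))
  sum-next-dihedral {k = k} w w-sym us e = trans
    (sum-cong-≋ {k} (λ i → reflexive (cong₂ w (lookup-reindex us π i) (lookup-reindex us π (next i)))))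
    (permuted (dihedral-step e))
    where
    π = dihedral e
    f = lookup us

    permuted : Rotates (π ⟨$⟩ʳ_) ⊎ Reflects (π ⟨$⟩ʳ_) →
      sum (λ i → w (f (π ⟨$⟩ʳ i)) (f (π ⟨$⟩ʳ next i))) ≈ sum (λ i → w (f i) (f (next i)))
    permuted (inj₁ rot) = trans
      (sum-cong-≋ {k} (λ i → reflexive (cong (λ j → w (f (π ⟨$⟩ʳ i)) (f j)) (rot i))))
      (sym (sum-permute _ π))
    -- A reflection traverses each edge backwards, starting from position `π (next i)` of the
    -- original. Hence the symmetry of `w` and the extra `nextₚ` in the permutation.
    permuted (inj₂ ref) = trans
      (sum-cong-≋ {k} (λ i → trans
        (reflexive (cong (λ j → w (f j) (f (π ⟨$⟩ʳ next i))) (≡.sym (ref i)))) (w-sym _ _)))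
      (sym (sum-permute _ (nextₚ ∘ₚ π)))

∈-vertexSequences : ∀ {n k} (us : Vec (Fin n) k) → us ∈ vertexSequences n k
∈-vertexSequences []       = here ≡.refl
∈-vertexSequences (u ∷ us) = ∈-cartesianProductWith⁺ _∷_ (∈-allFin u) (∈-vertexSequences us)

vertexSequences-unique : ∀ n k → ListUnique.Unique (vertexSequences n k)
vertexSequences-unique n zero    = ListAll.[] ListAllPairs.∷ ListAllPairs.[]
vertexSequences-unique n (suc k) = ListUniqueₚ.cartesianProductWith⁺ _∷_ ∷-injective
  (ListUniqueₚ.allFin⁺ n) (vertexSequences-unique n k)

-- A cycle carries adjacency proofs that may not be unique, so counting is done on the underlying
-- vertex sequences.
proj₁-mapMaybe-dec : ∀ {A : Set} {P : Unary.Pred A 0ℓ} (P? : Unary.Decidable P) xs →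
  map proj₁ (mapMaybe (λ x → Maybe.map (x ,_) (dec⇒maybe (P? x))) xs) ≡ filter P? xs
proj₁-mapMaybe-dec P? []       = ≡.refl
proj₁-mapMaybe-dec P? (x ∷ xs) with P? x
... | yes _ = cong (x ∷_) (proj₁-mapMaybe-dec P? xs)
... | no  _ = proj₁-mapMaybe-dec P? xs

module CycleTraversals {n} (G : Graph n) (k : ℕ) where
  open Graph G
  open Cycles G k

  proj₁-traversals : map proj₁ traversals ≡ filter isCycle? (vertexSequences n k)
  proj₁-traversals = proj₁-mapMaybe-dec isCycle? (vertexSequences n k)

  isCycle-reindex : ∀ {us} e → IsCycle us → IsCycle (reindex us (dihedral e))
  isCycle-reindex {us} e (isCycle us! adj) = isCycle
    (tabulate⁺ (⟨$⟩ʳ-injective (dihedral e) ∘ lookup-injective us! _ _))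
    λ i → ≡.subst₂ Adj (≡.sym (lookup-reindex us π i)) (≡.sym (lookup-reindex us π (next i)))
      (adjacent (dihedral-step e) i)
    where
    π = dihedral e

    adjacent : Rotates (π ⟨$⟩ʳ_) ⊎ Reflects (π ⟨$⟩ʳ_) →
               ∀ i → Adj (lookup us (π ⟨$⟩ʳ i)) (lookup us (π ⟨$⟩ʳ next i))
    adjacent (inj₁ rot)  i = ≡.subst (λ j → Adj (lookup us (π ⟨$⟩ʳ i)) (lookup us j)) (≡.sym (rot i)) (adj (π ⟨$⟩ʳ i))
    adjacent (inj₂ ref) i = sym (≡.subst (λ j → Adj (lookup us (π ⟨$⟩ʳ next i)) (lookup us j)) (ref i) (adj (π ⟨$⟩ʳ next i)))

  ≋-refl : ∀ {C} → C ≋ C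
  ≋-refl u v = id , id

  ≋-sym : ∀ {C D} → C ≋ D → D ≋ C
  ≋-sym C≋D u v = proj₂ (C≋D u v) , proj₁ (C≋D u v)

  ≋-trans : ∀ {C D E} → C ≋ D → D ≋ E → C ≋ E
  ≋-trans C≋D D≋E u v = proj₁ (D≋E u v) ∘ proj₁ (C≋D u v) , proj₂ (C≋D u v) ∘ proj₂ (D≋E u v)

  reindex-≋ : ∀ {C D} e → proj₁ D ≡ reindex (proj₁ C) (dihedral e) → D ≋ C
  reindex-≋ {us , C} {_ , D} e ≡.refl u v = to (dihedral-step e) , from (dihedral-step e)
    where
    π = dihedral e
    vs = reindex us π
    f = lookup us

    at : ∀ i {x} → lookup vs i ≡ x → f (π ⟨$⟩ʳ i) ≡ x
    at i = ≡.trans (≡.sym (lookup-reindex us π i))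

    at⁻ : ∀ i {j x} → f j ≡ x → π ⟨$⟩ʳ i ≡ j → lookup vs i ≡ x
    at⁻ i fj≡x ≡.refl = ≡.trans (lookup-reindex us π i) fj≡x

    to : Rotates (π ⟨$⟩ʳ_) ⊎ Reflects (π ⟨$⟩ʳ_) → EdgeOf (vs , D) u v → EdgeOf (us , C) u v
    to (inj₁ rot)  (i , inj₁ (p , q)) = π ⟨$⟩ʳ i ,
      inj₁ (at i p , ≡.trans (cong f (≡.sym (rot i))) (at (next i) q))
    to (inj₁ rot)  (i , inj₂ (p , q)) = π ⟨$⟩ʳ i ,
      inj₂ (at i p , ≡.trans (cong f (≡.sym (rot i))) (at (next i) q))
    to (inj₂ ref) (i , inj₁ (p , q)) = π ⟨$⟩ʳ next i ,
      inj₂ (at (next i) q , ≡.trans (cong f (ref i)) (at i p))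
    to (inj₂ ref) (i , inj₂ (p , q)) = π ⟨$⟩ʳ next i ,
      inj₁ (at (next i) q , ≡.trans (cong f (ref i)) (at i p))

    from : Rotates (π ⟨$⟩ʳ_) ⊎ Reflects (π ⟨$⟩ʳ_) → EdgeOf (us , C) u v → EdgeOf (vs , D) u v
    from (inj₁ rot) (j , pq) = i , lift pq
      where
      i = π ⟨$⟩ˡ j
      πi≡j : π ⟨$⟩ʳ i ≡ j
      πi≡j = Perm.inverseʳ π
      lift : ∀ {x y z t} → (f j ≡ x × f (next j) ≡ y) ⊎ (f j ≡ z × f (next j) ≡ t) →
             (lookup vs i ≡ x × lookup vs (next i) ≡ y) ⊎ (lookup vs i ≡ z × lookup vs (next i) ≡ t)
      lift (inj₁ (p , q)) = inj₁ (at⁻ i p πi≡j , at⁻ (next i) q (≡.trans (rot i) (cong next πi≡j)))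
      lift (inj₂ (p , q)) = inj₂ (at⁻ i p πi≡j , at⁻ (next i) q (≡.trans (rot i) (cong next πi≡j)))
    from (inj₂ ref) (j , pq) = i , lift pq
      where
      -- The edge at `j` is traversed backwards, so its preimage must satisfy `π (next i) ≡ j`, not
      -- `π i ≡ j`.
      i = (nextₚ ∘ₚ π) ⟨$⟩ˡ j
      π-next-i≡j : π ⟨$⟩ʳ next i ≡ j
      π-next-i≡j = Perm.inverseʳ (nextₚ ∘ₚ π)
      πi≡next-j : π ⟨$⟩ʳ i ≡ next j
      πi≡next-j = ≡.trans (≡.sym (ref i)) (cong next π-next-i≡j)
      lift : (f j ≡ u × f (next j) ≡ v) ⊎ (f j ≡ v × f (next j) ≡ u) →
             (lookup vs i ≡ u × lookup vs (next i) ≡ v) ⊎ (lookup vs i ≡ v × lookup vs (next i) ≡ u)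
      lift (inj₁ (p , q)) = inj₂ (at⁻ i q πi≡next-j , at⁻ (next i) p π-next-i≡j)
      lift (inj₂ (p , q)) = inj₁ (at⁻ i q πi≡next-j , at⁻ (next i) p π-next-i≡j)

  module _ (k≥3 : k ≥ 3) where

    -- Every vertex of `D` starts an edge of `D`, which is also an edge of `C`; this locates the
    -- vertex in `us`, at a unique position by distinctness. The same edge shows that consecutive
    -- positions differ by one step in some direction.
    ≋⇒reindex : ∀ {C D} → D ≋ C → ∃ λ e → proj₁ D ≡ reindex (proj₁ C) (dihedral e)
    ≋⇒reindex {us , isCycle us! _} {vs , isCycle vs! _} D≋C =
      let e , σ≗ = steps⇒dihedral k≥3 position position-injective step in
      e , ≡.trans (≡.sym (tabulate∘lookup vs))
        (tabulate-cong (λ i → ≡.trans (≡.sym (position-correct i)) (cong (lookup us) (σ≗ i))))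
      where
      us-injective : ∀ {i j} → lookup us i ≡ lookup us j → i ≡ j
      us-injective = lookup-injective us! _ _

      edge : ∀ i → ∃ λ j →
        (lookup us j ≡ lookup vs i × lookup us (next j) ≡ lookup vs (next i)) ⊎
        (lookup us j ≡ lookup vs (next i) × lookup us (next j) ≡ lookup vs i)
      edge i = proj₁ (D≋C (lookup vs i) (lookup vs (next i))) (i , inj₁ (≡.refl , ≡.refl))

      located : ∀ i → ∃ λ j → lookup us j ≡ lookup vs i
      located i with edge i
      ... | j , inj₁ (p , _) = j , p
      ... | j , inj₂ (_ , q) = next j , q

      position : Fin k → Fin k
      position i = proj₁ (located i)

      position-correct : ∀ i → lookup us (position i) ≡ lookup vs i
      position-correct i = proj₂ (located i)

      position-injective : ∀ {i j} → position i ≡ position j → i ≡ j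
      position-injective {i} {j} eq = lookup-injective vs! i j
        (≡.trans (≡.sym (position-correct i)) (≡.trans (cong (lookup us) eq) (position-correct j)))

      position-unique : ∀ {i j} → lookup us j ≡ lookup vs i → position i ≡ j
      position-unique {i} eq = us-injective (≡.trans (position-correct i) (≡.sym eq))

      step : ∀ i → (position (next i) ≡ next (position i)) ⊎ (next (position (next i)) ≡ position i)
      step i = oriented (edge i)
        where
        oriented : (∃ λ j → (lookup us j ≡ lookup vs i × lookup us (next j) ≡ lookup vs (next i)) ⊎
                            (lookup us j ≡ lookup vs (next i) × lookup us (next j) ≡ lookup vs i)) →
                   (position (next i) ≡ next (position i)) ⊎ (next (position (next i)) ≡ position i)
        oriented (j , inj₁ (p , q)) = inj₁ (≡.trans (position-unique q) (cong next (≡.sym (position-unique p))))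
        oriented (j , inj₂ (p , q)) = inj₂ (≡.trans (cong next (position-unique p)) (≡.sym (position-unique q)))

    -- The class and the dihedral orbit, enumerated by `Fin (k ℕ.+ k)` as k rotations and k
    -- reflections, are duplicate-free lists with the same members, hence permutations of each
    -- other.
    classSize : ∀ C → length (filter (_≋? C) traversals) ≡ 2 ℕ.* k
    classSize C@(us , isCycle us! _) = begin
      length class              ≡⟨ length-map proj₁ class ⟨
      length (map proj₁ class)  ≡⟨ ↭-length (∼bag⇒↭ (unique∧set⇒bag class-unique orbit-unique (mk⇔ to from))) ⟩
      length orbit              ≡⟨ length-tabulate turn ⟩
      k ℕ.+ k                   ≡⟨ cong (k ℕ.+_) (ℕₚ.+-identityʳ k) ⟨
      2 ℕ.* k                   ∎
      where
      open ≡.≡-Reasoning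

      class : List Cycle
      class = filter (_≋? C) traversals

      turn : Fin (k ℕ.+ k) → Vec (Fin n) k
      turn = reindex us ∘ dihedral ∘ splitAt k

      orbit : List (Vec (Fin n) k)
      orbit = List.tabulate turn

      class-unique : ListUnique.Unique (map proj₁ class)
      class-unique = ListAllPairsₚ.map⁺ (ListAllPairsₚ.filter⁺ (_≋? C) (ListAllPairsₚ.map⁻
        (≡.subst ListUnique.Unique (≡.sym proj₁-traversals)
          (ListUniqueₚ.filter⁺ isCycle? (vertexSequences-unique n k)))))

      turn-injective : ∀ {i j} → turn i ≡ turn j → i ≡ j
      turn-injective {i} {j} eq = ≡.trans (≡.sym (join-splitAt k k i)) (≡.trans
        (cong (join k k) (dihedral-injective k≥3 (splitAt k i) (splitAt k j) (λ l →
          lookup-injective us! _ _ (≡.trans (≡.sym (lookup∘tabulate _ l))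
            (≡.trans (cong (λ vs → lookup vs l) eq) (lookup∘tabulate _ l))))))
        (join-splitAt k k j))

      orbit-unique : ListUnique.Unique orbit
      orbit-unique = ListUniqueₚ.tabulate⁺ turn-injective

      to : ∀ {vs} → vs ∈ map proj₁ class → vs ∈ orbit
      to vs∈ with ∈-map⁻ proj₁ vs∈
      ... | D , D∈ , ≡.refl with ≋⇒reindex {C} {D} (proj₂ (∈-filter⁻ (_≋? C) {xs = traversals} D∈))
      ...   | e , eq = ≡.subst (_∈ orbit)
        (≡.trans (cong (reindex us ∘ dihedral) (splitAt-join k k e)) (≡.sym eq)) (∈-tabulate⁺ (join k k e))

      from : ∀ {vs} → vs ∈ orbit → vs ∈ map proj₁ class
      from vs∈ with ∈-tabulate⁻ vs∈
      -- The listed traversal `D` has the turned vertex sequence but possibly another cycle proof;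
      -- `reindex-≋` accepts any such proof.
      ... | i , ≡.refl with ∈-map⁻ proj₁ (≡.subst (turn i ∈_) (≡.sym proj₁-traversals)
              (∈-filter⁺ isCycle? (∈-vertexSequences (turn i)) (isCycle-reindex (splitAt k i) (proj₂ C))))
      ...   | D , D∈ , eq = ≡.subst (_∈ map proj₁ class) (≡.sym eq)
        (∈-map⁺ proj₁ (∈-filter⁺ (_≋? C) D∈ (reindex-≋ {C} {D} (splitAt k i) (≡.sym eq))))

-- Closed walks

-- Translates the endpoints of a walk that returns to `u` into cyclic indexing; the appended `u` is
-- the wrap-around.
lookup-∷ʳ-next : ∀ {A : Set} {k} (us : Vec A k) u i → lookup (us ∷ʳ u) i ≡ lookup (u ∷ us) (next i)
lookup-∷ʳ-next {A} {k} us u i with view i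
... | ‵fromℕ     = ≡.trans (last us) (cong (lookup (u ∷ us)) (≡.sym (next-fromℕ k)))
  where
  last : ∀ {k} (us : Vec A k) → lookup (us ∷ʳ u) (fromℕ k) ≡ u
  last []       = ≡.refl
  last (_ ∷ us) = last us
... | ‵inject₁ j = ≡.trans (init us j) (cong (lookup (u ∷ us)) (≡.sym (next-inject₁ j)))
  where
  init : ∀ {k} (us : Vec A k) j → lookup (us ∷ʳ u) (inject₁ j) ≡ lookup us j
  init (_ ∷ us) zero    = ≡.refl
  init (_ ∷ us) (suc j) = init us j

module _ (S : CommutativeSemiring c ℓ) where
  open CommutativeSemiring S
  open RawSemiringOps rawSemiring using (product)

  product-0 : ∀ {k} (f : Fin k → Carrier) i → f i ≈ 0# → product f ≈ 0#
  product-0 f zero    eq = trans (*-congʳ eq) (zeroˡ _)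
  product-0 f (suc i) eq = trans (*-congˡ (product-0 (f ∘ suc) i eq)) (zeroʳ _)

module ClosedWalks (S : CommutativeSemiring c ℓ) (n : ℕ) where
  open CommutativeSemiring S hiding (_*_)
  open CommutativeSemiring S using () renaming (_*_ to _·_)
  open RawSemiringOps rawSemiring using (product)
  open Matrix rawSemiring n
  open ListSum +-commutativeMonoid
  open FinSum +-commutativeMonoid using (sum; sum-cong-≋; sum-replicate-zero)
  open FinSum *-commutativeMonoid using () renaming (sum-cong-≋ to product-cong; ∑-distrib-+ to product-distrib-*)
  open import Relation.Binary.Reasoning.Setoid setoid

  Σ-distribˡ : ∀ {I : Set} x (is : List I) f → x · Σ is f ≈ Σ is (λ i → x · f i)
  Σ-distribˡ x []       f = zeroʳ x
  Σ-distribˡ x (i ∷ is) f = trans (distribˡ x _ _) (+-congˡ (Σ-distribˡ x is f))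

  sum-select : ∀ {m} (i : Fin m) (f : Fin m → Carrier) → sum (λ l → if does (i ≟ l) then f l else 0#) ≈ f i
  sum-select {suc m} zero    f = trans (+-congˡ (sum-replicate-zero m)) (+-identityʳ _)
  sum-select {suc m} (suc i) f = trans (+-identityˡ _) (sum-select i (f ∘ suc))

  if-*ʳ : ∀ b x y → (if b then x else 0#) · y ≈ (if b then x · y else 0#)
  if-*ʳ true  x y = refl
  if-*ʳ false x y = zeroˡ y

  diag-* : ∀ d B i j → (diag d * B) i j ≈ d i · B i j
  diag-* d B i j = trans
    (sum-cong-≋ {n} (λ l → if-*ʳ (does (i ≟ l)) (d i) (B l j)))
    (sum-select i (λ l → d i · B l j))

  -- The first power of a matrix unfolds to its product with the identity, so the base case of
  -- `^-walks` needs this law.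
  *-1 : ∀ A i j → (A * diag (λ _ → 1#)) i j ≈ A i j
  *-1 A i j = trans
    (sum-cong-≋ {n} (λ l → trans (*-comm _ _) (trans
      (if-*ʳ (does (l ≟ j)) 1# (A i l))
      (reflexive (cong (λ b → if b then 1# · A i l else 0#) (does-⇔ (mk⇔ ≡.sym ≡.sym) (l ≟ j) (j ≟ l)))))))
    (trans (sum-select j (λ l → 1# · A i l)) (*-identityˡ _))

  module _ (A : Mat) where

    -- Only the inner vertices are listed: `u ∷ us` gives the sources of the steps and `us ∷ʳ v`
    -- their targets.
    walk : ∀ {k} → Fin n → Vec (Fin n) k → Fin n → Carrier
    walk u us v = product (λ i → A (lookup (u ∷ us) i) (lookup (us ∷ʳ v) i))

    ^-walks : ∀ k u v → (A ^ suc k) u v ≈ Σ (vertexSequences n k) (λ us → walk u us v)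
    ^-walks zero    u v = trans (*-1 A u v) (trans (sym (*-identityʳ _)) (sym (+-identityʳ _)))
    ^-walks (suc k) u v = begin
      sum (λ l → A u l · (A ^ suc k) l v)
        ≈⟨ sum-cong-≋ {n} (λ l → trans (*-congˡ (^-walks k l v)) (Σ-distribˡ (A u l) (vertexSequences n k) _)) ⟩
      sum (λ l → Σ (vertexSequences n k) (λ us → A u l · walk l us v))
        -- `walk u (l ∷ us) v` unfolds to `A u l · walk l us v`, so only the shape of the outer sum
        -- changes.
        ≡⟨ Σ-tabulate {n = n} id _ ⟨
      Σ (allFin n) (λ l → Σ (vertexSequences n k) (λ us → walk u (l ∷ us) v))
        ≈⟨ Σ-cartesianProductWith _∷_ (allFin n) (vertexSequences n k) _ ⟨
      Σ (vertexSequences n (suc k)) (λ us → walk u us v) ∎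

    tr-^ : ∀ k → tr (A ^ suc k) ≈
      Σ (vertexSequences n (suc k)) (λ us → product (λ i → A (lookup us i) (lookup us (next i))))
    tr-^ k = begin
      sum (λ u → (A ^ suc k) u u)
        ≈⟨ sum-cong-≋ {n} (λ u → ^-walks k u u) ⟩
      sum (λ u → Σ (vertexSequences n k) (λ us → walk u us u))
        ≡⟨ Σ-tabulate {n = n} id _ ⟨
      Σ (allFin n) (λ u → Σ (vertexSequences n k) (λ us → walk u us u))
        ≈⟨ Σ-cong (allFin n) (λ u → Σ-cong (vertexSequences n k) (λ us →
             product-cong {suc k} (λ i → reflexive (cong (A (lookup (u ∷ us) i)) (lookup-∷ʳ-next us u i))))) ⟩
      Σ (allFin n) (λ u → Σ (vertexSequences n k) (λ us →
        product (λ i → A (lookup (u ∷ us) i) (lookup (u ∷ us) (next i)))))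
        ≈⟨ Σ-cartesianProductWith _∷_ (allFin n) (vertexSequences n k) _ ⟨
      Σ (vertexSequences n (suc k)) (λ us → product (λ i → A (lookup us i) (lookup us (next i)))) ∎

  -- Left multiplication by a diagonal matrix gives each step the factor of its source, and every
  -- position of a closed walk is the source of exactly one step.
  tr-diag-*-^ : ∀ d B k → tr ((diag d * B) ^ suc k) ≈ Σ (vertexSequences n (suc k)) (λ us →
    product (λ i → B (lookup us i) (lookup us (next i))) · product (λ i → d (lookup us i)))
  tr-diag-*-^ d B k = trans (tr-^ (diag d * B) k) (Σ-cong (vertexSequences n (suc k)) (λ us →
    trans (product-cong {suc k} (λ i → trans (diag-* d B (lookup us i) (lookup us (next i))) (*-comm _ _)))
      (product-distrib-* {suc k} (λ i → B (lookup us i) (lookup us (next i))) (λ i → d (lookup us i)))))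

-- Rational coefficients

fromℚᵘ-homo-+ : ∀ p q → fromℚᵘ (p ℚᵘ.+ q) ≡ fromℚᵘ p ℚ.+ fromℚᵘ q
fromℚᵘ-homo-+ p q = ℚₚ.toℚᵘ-injective (begin
  toℚᵘ (fromℚᵘ (p ℚᵘ.+ q))                ≈⟨ ℚₚ.toℚᵘ-fromℚᵘ (p ℚᵘ.+ q) ⟩
  p ℚᵘ.+ q                                ≈⟨ ℚᵘₚ.+-cong (ℚₚ.toℚᵘ-fromℚᵘ p) (ℚₚ.toℚᵘ-fromℚᵘ q) ⟨
  toℚᵘ (fromℚᵘ p) ℚᵘ.+ toℚᵘ (fromℚᵘ q)    ≈⟨ ℚₚ.toℚᵘ-homo-+ (fromℚᵘ p) (fromℚᵘ q) ⟨
  toℚᵘ (fromℚᵘ p ℚ.+ fromℚᵘ q)            ∎)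
  where open import Relation.Binary.Reasoning.Setoid ℚᵘₚ.≃-setoid

fromℚᵘ-homo-* : ∀ p q → fromℚᵘ (p ℚᵘ.* q) ≡ fromℚᵘ p ℚ.* fromℚᵘ q
fromℚᵘ-homo-* p q = ℚₚ.toℚᵘ-injective (begin
  toℚᵘ (fromℚᵘ (p ℚᵘ.* q))                ≈⟨ ℚₚ.toℚᵘ-fromℚᵘ (p ℚᵘ.* q) ⟩
  p ℚᵘ.* q                                ≈⟨ ℚᵘₚ.*-cong (ℚₚ.toℚᵘ-fromℚᵘ p) (ℚₚ.toℚᵘ-fromℚᵘ q) ⟨
  toℚᵘ (fromℚᵘ p) ℚᵘ.* toℚᵘ (fromℚᵘ q)    ≈⟨ ℚₚ.toℚᵘ-homo-* (fromℚᵘ p) (fromℚᵘ q) ⟨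
  toℚᵘ (fromℚᵘ p ℚ.* fromℚᵘ q)            ∎)
  where open import Relation.Binary.Reasoning.Setoid ℚᵘₚ.≃-setoid

-- By definition `a ℚ./ 1` is `fromℚᵘ (mkℚᵘ a 0)`, so the identity reduces to cross multiplication
-- of unreduced fractions.
/1-homo-+ : ∀ a b → (a ℤ.+ b) ℚ./ 1 ≡ a ℚ./ 1 ℚ.+ b ℚ./ 1
/1-homo-+ a b = ≡.trans
  (ℚₚ.fromℚᵘ-cong {mkℚᵘ (a ℤ.+ b) 0} {mkℚᵘ a 0 ℚᵘ.+ mkℚᵘ b 0} (*≡* (cong (ℤ._* + 1)
    (cong₂ ℤ._+_ (≡.sym (ℤₚ.*-identityʳ a)) (≡.sym (ℤₚ.*-identityʳ b))))))
  (fromℚᵘ-homo-+ (mkℚᵘ a 0) (mkℚᵘ b 0))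

×≡* : ∀ m z → RawMonoidOps._×_ ℤ.+-0-rawMonoid m z ≡ + m ℤ.* z
×≡* zero    z = ≡.refl
×≡* (suc m) z = ≡.trans (cong (λ y → z ℤ.+ y) (×≡* m z)) (≡.sym (ℤₚ.suc-* (+ m) z))

1/[2*]-cancel : ∀ k (k≥3 : k ≥ 3) z → 1/[2* k ] k≥3 ℚ.* ((+ (2 ℕ.* k) ℤ.* z) ℚ./ 1) ≡ z ℚ./ 1
1/[2*]-cancel (suc k) k≥3 z = ≡.trans (≡.sym (fromℚᵘ-homo-* p q))
  (ℚₚ.fromℚᵘ-cong {p ℚᵘ.* q} {mkℚᵘ z 0} (*≡* cross))
  where
  -- `mkℚᵘ` stores the denominator minus one.
  d = ℕ.pred (2 ℕ.* suc k)
  p = mkℚᵘ (+ 1) d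
  q = mkℚᵘ (+ suc d ℤ.* z) 0

  rearranged : ∀ x y → (+ 1 ℤ.* (x ℤ.* y)) ℤ.* + 1 ≡ y ℤ.* (x ℤ.* + 1)
  rearranged = solve-∀

  cross : (+ 1 ℤ.* (+ suc d ℤ.* z)) ℤ.* + 1 ≡ z ℤ.* (+ suc d ℤ.* + 1)
  cross = rearranged (+ suc d) z

coeff-ι : ∀ P α → ℚ[w,r].coeff (ι P) α ≡ ℤ[w,r].coeff P α ℚ./ 1
coeff-ι []            α = ≡.refl
coeff-ι ((a , β) ∷ P) α with does (≡-dec ℕₚ._≟_ β α)
... | true  = ≡.trans (cong (a ℚ./ 1 ℚ.+_) (coeff-ι P α)) (≡.sym (/1-homo-+ a _))
... | false = coeff-ι P α

module AP = PolynomialProperties ℤ.+-*-rawRing ℤₚ.+-*-isCommutativeSemiring 2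
module QP = PolynomialProperties ℚ.+-*-rawRing
  (IsCommutativeRing.isCommutativeSemiring ℚₚ.+-*-isCommutativeRing) 2

-- The squarefree part of the trace

-- Polynomial equality unfolds to a function type from which the two polynomials cannot
-- be inferred, hence the many implicit arguments given explicitly.
module CycleSum {n} (G : Graph n) (weight : EdgeWeight G) (k : ℕ) where
  open Graph G
  open EdgeWeight weight
  open Weighted G weight hiding (IsCycle; isCycle; isCycle?; Cycle; _≋_; _≋?_; traversals; 𝒞)
  open Cycles G k
  open CycleTraversals G k

  module BP = PolynomialProperties ℤ[w,r].rawRing AP.poly-isCommutativeSemiring n
  module A where
    open ℤ[w,r] public using (product; 0#; 1#)
    open CommutativeSemiring AP.commutativeSemiring public hiding (0#; 1#)
    open RawMonoidOps +-rawMonoid public using () renaming (_×_ to _·_)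
  module B where
    open ℤ[w,r][x] n public using (const; var; SF; product; eval; sq; _·_; 0#)
    open CommutativeSemiring BP.commutativeSemiring public hiding (0#)
  module AΣ = ListSum A.+-commutativeMonoid
  module BΣ = ListSum B.+-commutativeMonoid

  m-cong : ∀ {u v} (p : Adj u v) → wg p A.≈ m u v
  m-cong {u} {v} p with adj? u v
  -- The proof `q` found by `adj?` may differ from `p`; the two weights are compared through the
  -- reversed edge.
  ... | yes q  = A.trans {wg p} {wg (sym p)} {wg q} (wg-sym p (sym p)) (wg-sym (sym p) q)
  ... | no  ¬p = contradiction p ¬p

  m-sym : ∀ u v → m u v A.≈ m v u
  m-sym u v with adj? u v | adj? v u
  ... | yes p | yes q = wg-sym p q
  ... | yes p | no ¬q = contradiction (sym p) ¬q
  ... | no ¬p | yes q = contradiction (sym q) ¬p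
  ... | no _  | no _  = A.refl {A.0#}

  m-0 : ∀ {u v} → ¬ Adj u v → m u v A.≈ A.0#
  m-0 {u} {v} ¬p with adj? u v
  ... | yes p = contradiction p ¬p
  ... | no  _ = A.refl {A.0#}

  walkWeight : Vec (Fin n) k → A.Carrier
  walkWeight us = A.product (λ i → m (lookup us i) (lookup us (next i)))

  walkTerm : Vec (Fin n) k → B.Carrier
  walkTerm us = B.const (walkWeight us) B.* B.product (λ i → B.var (lookup us i))

  wg-cycle≈walkWeight : ∀ C → wg-cycle C A.≈ walkWeight (proj₁ C)
  wg-cycle≈walkWeight (us , isCycle _ adj) =
    FinSum.sum-cong-≋ A.*-commutativeMonoid {k} {λ i → wg (adj i)} (λ i → m-cong (adj i))

  walkTerm-0 : ∀ us → ¬ (∀ i → Adj (lookup us i) (lookup us (next i))) → walkTerm us B.≈ B.0#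
  walkTerm-0 us ¬adj with ¬∀⟶∃¬ k _ (λ i → adj? (lookup us i) (lookup us (next i))) ¬adj
  ... | i , ¬p = B.trans {walkTerm us} {B.0# B.* xs} {B.0#}
    (B.*-cong {B.const (walkWeight us)} {B.0#} {xs} {xs}
      (B.trans {B.const (walkWeight us)} {B.const A.0#} {B.0#}
        (BP.const-cong {walkWeight us} {A.0#} (product-0 AP.commutativeSemiring (λ i → m (lookup us i) (lookup us (next i))) i (m-0 ¬p))) BP.const-0)
      (B.refl {xs}))
    (B.zeroˡ xs)
    where xs = B.product (λ i → B.var (lookup us i))

  SF-walkTerm : ∀ us → B.SF (walkTerm us) B.≈ BΣ.[ does (isCycle? us) ]· walkTerm us
  SF-walkTerm us = by-cases (isCycle? us) (allPairs? (λ i j → ¬? (i ≟ j)) us)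
    where
    by-cases : (C? : Dec (IsCycle us)) → Dec (Unique us) → B.SF (walkTerm us) B.≈ BΣ.[ does C? ]· walkTerm us
    by-cases (yes C) _         = B.reflexive (BP.SF-monomial-unique (walkWeight us) us (IsCycle.distinct C))
    -- Here `SF` keeps the term, which vanishes because some factor of its weight belongs to a
    -- non-adjacent pair.
    by-cases (no ¬C) (yes us!) = B.trans {B.SF (walkTerm us)} {walkTerm us} {B.0#}
      (B.reflexive (BP.SF-monomial-unique (walkWeight us) us us!)) (walkTerm-0 us (¬C ∘ isCycle us!))
    by-cases (no _)  (no ¬us!) = B.reflexive (BP.SF-monomial-¬unique (walkWeight us) us ¬us!)

  walkTerm-reindex : ∀ us e → walkTerm (reindex us (dihedral e)) B.≈ walkTerm us
  walkTerm-reindex us e = B.*-cong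
    {B.const (walkWeight vs)} {B.const (walkWeight us)}
    {B.product (λ i → B.var (lookup vs i))} {B.product (λ i → B.var (lookup us i))}
    (BP.const-cong {walkWeight vs} {walkWeight us} (sum-next-dihedral A.*-commutativeMonoid m m-sym us e))
    (sum-reindex B.*-commutativeMonoid B.var us (dihedral e))
    where vs = reindex us (dihedral e)

  cycleTerm : Cycle → B.Carrier
  cycleTerm C = B.const (wg-cycle C) B.* vertexMonomial C

  walkTerm≈cycleTerm : ∀ C → walkTerm (proj₁ C) B.≈ cycleTerm C
  walkTerm≈cycleTerm C = B.*-cong
    {B.const (walkWeight (proj₁ C))} {B.const (wg-cycle C)} {vertexMonomial C} {vertexMonomial C}
    (BP.const-cong {walkWeight (proj₁ C)} {wg-cycle C} (A.sym {wg-cycle C} {walkWeight (proj₁ C)} (wg-cycle≈walkWeight C)))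
    (B.refl {vertexMonomial C})

  cycleSum : B.Carrier
  cycleSum = BΣ.Σ 𝒞 cycleTerm

module Trace {n} (G : Graph n) (weight : EdgeWeight G) (k-1 : ℕ) (k≥3 : suc k-1 ≥ 3) where
  private k = suc k-1
  open CycleSum G weight k
  open Weighted G weight hiding (IsCycle; isCycle; isCycle?; Cycle; _≋_; _≋?_; traversals; 𝒞)
  open Cycles G k
  open CycleTraversals G k
  open import Relation.Binary.Reasoning.Setoid B.setoid

  -- The constant entries along a walk are gathered into one constant, so that each walk contributes
  -- a single term and `SF` either keeps or deletes it.
  tr-walks : tr ((X * M) ^ k) B.≈ BΣ.Σ (vertexSequences n k) walkTerm
  tr-walks = B.trans {tr ((X * M) ^ k)} {BΣ.Σ (vertexSequences n k) walkTerm′} {BΣ.Σ (vertexSequences n k) walkTerm}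
    (ClosedWalks.tr-diag-*-^ BP.commutativeSemiring n B.var M k-1)
    (BΣ.Σ-cong (vertexSequences n k) {walkTerm′} {walkTerm} λ us → B.reflexive (cong (B._* B.product (λ i → B.var (lookup us i)))
      (≡.sym (BP.const-product (λ i → m (lookup us i) (lookup us (next i)))))))
    where
    walkTerm′ : Vec (Fin n) k → B.Carrier
    walkTerm′ us = B.product (λ i → M (lookup us i) (lookup us (next i))) B.* B.product (λ i → B.var (lookup us i))

  SF-trace : B.SF (tr ((X * M) ^ k)) B.≈ (2 ℕ.* k) B.· cycleSum
  SF-trace = begin
    B.SF (tr ((X * M) ^ k))
      ≈⟨ BP.SF-cong {tr ((X * M) ^ k)} {BΣ.Σ walks walkTerm} tr-walks ⟩
    B.SF (BΣ.Σ walks walkTerm)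
      ≡⟨ BP.SF-∑ walks walkTerm ⟩
    BΣ.Σ walks (B.SF ∘ walkTerm)
      ≈⟨ BΣ.Σ-cong walks {B.SF ∘ walkTerm} {λ us → BΣ.[ does (isCycle? us) ]· walkTerm us} SF-walkTerm ⟩
    BΣ.Σ walks (λ us → BΣ.[ does (isCycle? us) ]· walkTerm us)
      ≈⟨ BΣ.Σ-filter isCycle? walks walkTerm ⟨
    BΣ.Σ (filter isCycle? walks) walkTerm
      ≡⟨ cong (λ uss → BΣ.Σ uss walkTerm) proj₁-traversals ⟨
    BΣ.Σ (map proj₁ traversals) walkTerm
      ≡⟨ BΣ.Σ-map proj₁ traversals walkTerm ⟩
    BΣ.Σ traversals (walkTerm ∘ proj₁)
      ≈⟨ BΣ.Σ-equalClasses _≋?_ (λ {C} → ≋-refl {C}) (λ {C} {D} → ≋-sym {C} {D}) (λ {C} {D} {E} → ≋-trans {C} {D} {E})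
           traversals (2 ℕ.* k) (walkTerm ∘ proj₁) (λ {C} {D} → walkTerm-resp {C} {D}) (classSize k≥3) ⟩
    (2 ℕ.* k) B.· BΣ.Σ 𝒞 (walkTerm ∘ proj₁)
      ≈⟨ Mult.×-congʳ B.+-commutativeMonoid (2 ℕ.* k) {BΣ.Σ 𝒞 (walkTerm ∘ proj₁)} {cycleSum} (BΣ.Σ-cong 𝒞 {walkTerm ∘ proj₁} {cycleTerm} walkTerm≈cycleTerm) ⟩
    (2 ℕ.* k) B.· cycleSum ∎
    where
    walks = vertexSequences n k

    walkTerm-resp : ∀ {C D} → D ≋ C → walkTerm (proj₁ D) B.≈ walkTerm (proj₁ C)
    walkTerm-resp {C} {D} D≋C with ≋⇒reindex k≥3 {C} {D} D≋C
    ... | e , eq = B.trans {walkTerm (proj₁ D)} {walkTerm (reindex (proj₁ C) (dihedral e))} {walkTerm (proj₁ C)}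
      (B.reflexive (cong walkTerm eq)) (walkTerm-reindex (proj₁ C) e)

  -- This is `SF-trace` evaluated at all ones, where every vertex monomial becomes 1 and only the
  -- cycle weight remains.
  sq-trace : B.sq (tr ((X * M) ^ k)) A.≈ (2 ℕ.* k) A.· totalCycleWeight k
  sq-trace = A.trans {B.sq (tr ((X * M) ^ k))} {at1 ((2 ℕ.* k) B.· cycleSum)} {(2 ℕ.* k) A.· totalCycleWeight k}
    (BP.eval-cong (λ _ → A.1#) {B.SF (tr ((X * M) ^ k))} {(2 ℕ.* k) B.· cycleSum} SF-trace)
    (A.trans {at1 ((2 ℕ.* k) B.· cycleSum)} {(2 ℕ.* k) A.· at1 cycleSum} {(2 ℕ.* k) A.· totalCycleWeight k}
      (BP.eval-· (λ _ → A.1#) (2 ℕ.* k) cycleSum)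
      (Mult.×-congʳ A.+-commutativeMonoid (2 ℕ.* k) {at1 cycleSum} {totalCycleWeight k}
        (A.trans {at1 cycleSum} {AΣ.Σ 𝒞 (at1 ∘ cycleTerm)} {totalCycleWeight k}
          (BP.eval-∑ (λ _ → A.1#) 𝒞 cycleTerm)
          (AΣ.Σ-cong 𝒞 {at1 ∘ cycleTerm} {wg-cycle} λ C → BP.eval-1-monomial (wg-cycle C) (proj₁ C)))))
    where
    at1 : B.Carrier → A.Carrier
    at1 = B.eval (λ _ → A.1#)

  total-trace : ι (totalCycleWeight k) ℚ[w,r].≈ ℚ[w,r].const (1/[2* k ] k≥3) ℚ[w,r].* ι (B.sq (tr ((X * M) ^ k)))
  total-trace α = ≡.sym (≡R.begin
    ℚ[w,r].coeff (ℚ[w,r].const 1/2k ℚ[w,r].* ι S) α   ≡R.≡⟨ QP.coeff-const-* 1/2k (ι S) α ⟩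
    1/2k ℚ.* ℚ[w,r].coeff (ι S) α                     ≡R.≡⟨ cong (1/2k ℚ.*_) (coeff-ι S α) ⟩
    1/2k ℚ.* (ℤ[w,r].coeff S α ℚ./ 1)                 ≡R.≡⟨ cong (λ z → 1/2k ℚ.* (z ℚ./ 1)) (sq-trace α) ⟩
    -- The 2k-fold sum of polynomials becomes an integer multiple of one coefficient, which the
    -- rational factor can cancel.
    1/2k ℚ.* (ℤ[w,r].coeff ((2 ℕ.* k) A.· T) α ℚ./ 1) ≡R.≡⟨ cong (λ z → 1/2k ℚ.* (z ℚ./ 1)) (≡.trans (AP.coeff-· (2 ℕ.* k) T α) (×≡* (2 ℕ.* k) (ℤ[w,r].coeff T α))) ⟩
    1/2k ℚ.* ((+ (2 ℕ.* k) ℤ.* ℤ[w,r].coeff T α) ℚ./ 1) ≡R.≡⟨ 1/[2*]-cancel k k≥3 (ℤ[w,r].coeff T α) ⟩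
    ℤ[w,r].coeff T α ℚ./ 1                         ≡R.≡⟨ coeff-ι T α ⟨
    ℚ[w,r].coeff (ι T) α                           ≡R.∎)
    where
    module ≡R = ≡.≡-Reasoning
    1/2k = 1/[2* k ] k≥3
    S = B.sq (tr ((X * M) ^ k))
    T = totalCycleWeight k

theorem3p4 : ∀ {n} (G : Graph n) (weight : EdgeWeight G) (k : ℕ) (k≥3 : k ≥ 3) →
    let module R = ℤ[w,r][x] n
        module Q = ℚ[w,r]
        open Weighted G weight
    in
      (R.SF (tr ((X * M) ^ k))
         R.≈ (2 ℕ.* k) R.· ∑ R.+-rawMonoid (𝒞 k) (λ C → R.const (wg-cycle C) R.* vertexMonomial C))
    × (ι (totalCycleWeight k)
         Q.≈ Q.const (1/[2* k ] k≥3) Q.* ι (R.sq (tr ((X * M) ^ k))))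
theorem3p4 G weight (suc k) k≥3 = SF-trace , total-trace
  where open Trace G weight k k≥3
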